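{- Assume the continuum hypothesis ($2^{\aleph_0}=\aleph_1$). Then there is a group $G$ with the following properties: (a) $S\subseteq G\subseteq D$ and $G$ is pure in $D$ (hence also in $P$). (b) $\operatorname{End} G=\mathbb{Z}\oplus\operatorname{Fin} G$, i.e., every endomorphism of $G$ is almost scalar. (c) The dual group $G^*=\operatorname{Hom}(G,\mathbb{Z})$ is uncountable.
   Context: All groups are abelian. $P=\mathbb{Z}^{\aleph_0}=\prod_{i\in\omega}e_i\mathbb{Z}$ is the Baer-Specker group, the additive group of all integer-valued sequences, and $S=\mathbb{Z}^{(\aleph_0)}=\bigoplus_{i\in\omega}e_i\mathbb{Z}\subseteq P$ is the subgroup of sequences of finite support. $D$ is the $\mathbb{Z}$-adic closure of $S$ in $P$, i.e., the pre-image under the quotient map $P\to P/S$ of the maximal divisible subgroup of $P/S$; thus $S\subseteq D\subseteq P$ and $D/S$ is the maximal divisible subgroup of $P/S$. A subgroup $H$ of a group $K$ is pure in $K$ if $H\cap nK=nH$ for every integer $n$. $\operatorname{End}G$ is the endomorphism ring of $G$, and $\operatorname{Fin}G$ is the two-sided ideal of $\operatorname{End}G$ consisting of the endomorphisms whose image has finite rank. For $z\in\mathbb{Z}$, the endomorphism of $G$ given by multiplication by $z$ is also denoted $z$ and is called scalar; $\mathbb{Z}$ also denotes the set of scalar endomorphisms of $G$. An endomorphism of $G$ is almost scalar if it differs from a scalar endomorphism by an endomorphism whose image has finite rank. The direct sum in (b) is a direct sum of additive groups. -}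

module Defs where

open import Algebra.Bundles using (AbelianGroup)
import Algebra.Construct.Pointwise as Pointwise
import Algebra.Properties.AbelianGroup as AbelianGroupProperties
import Algebra.Properties.CommutativeMonoid.Mult as Mult
import Algebra.Properties.CommutativeSemigroup as CommutativeSemigroupProperties
open import Algebra.Definitions.RawMonoid using (sum)
open import Algebra.Morphism.Bundles using (GroupHomomorphism)
open import Data.Bool.Base using (Bool)
open import Data.Integer.Base as ℤ using (ℤ; +_; -[1+_])
import Data.Integer.Properties as ℤ
open import Data.Nat.Base as ℕ using (ℕ; zero; suc)
import Data.Nat.Properties as ℕ
open import Data.Product.Base using (Σ; ∃; Σ-syntax; ∃-syntax; _×_; _,_; proj₁; proj₂)
open import Data.Vec.Functional using (Vector; _∷_)
open import Function.Bundles using (Bijection; Func; Injection)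
open import Induction.WellFounded using (WellFounded)
open import Level using (0ℓ) renaming (suc to lsuc)
open import Relation.Binary.Bundles using (Setoid; StrictTotalOrder)
open import Relation.Binary.Core using (Rel; REL)
import Relation.Binary.Construct.On as On
open import Relation.Binary.Definitions using (_Respects_; _Respectsˡ_; _Respectsʳ_)
open import Relation.Binary.PropositionalEquality using (_≡_; refl; sym; trans; cong; subst; setoid; _→-setoid_)
import Relation.Binary.Reasoning.Setoid as SetoidReasoning
open import Relation.Nullary using (¬_)
open import Relation.Unary using (Pred; _⊆_; _∩_; _≐_)

------------------------------------------------------------------------
-- Set theory

-- Zermelo's axiom of choice: the choice function must preserve equality,
-- so this is not the choice principle that is provable for Σ-types.
AxiomOfChoice : ∀ ℓ → Set (lsuc ℓ)
AxiomOfChoice ℓ =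
  (A B : Setoid ℓ ℓ) (R : REL (Setoid.Carrier A) (Setoid.Carrier B) ℓ) →
  R Respectsˡ Setoid._≈_ A → R Respectsʳ Setoid._≈_ B →
  (∀ x → ∃[ y ] R x y) →
  Σ[ f ∈ Func A B ] (∀ x → R x (Func.to f x))

-- At most countable.
Countable : ∀ {c ℓ} → Setoid c ℓ → Set _
Countable X = Injection X (setoid ℕ)

Uncountable : ∀ {c ℓ} → Setoid c ℓ → Set _
Uncountable X = ¬ Countable X

module _ (W : StrictTotalOrder 0ℓ 0ℓ 0ℓ) where
  open StrictTotalOrder W

  InitialSegment : Carrier → Setoid 0ℓ 0ℓ
  InitialSegment w = On.setoid {B = ∃[ v ] v < w} Eq.setoid proj₁

  -- W is isomorphic to the ordinal ω₁, i.e. ℵ₁ as an initial ordinal.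
  record HasOrderTypeω₁ : Set where
    field
      wellFounded              : WellFounded _<_
      initialSegmentsCountable : ∀ w → Countable (InitialSegment w)
      uncountable              : Uncountable Eq.setoid

-- 2^ℵ₀ = ℵ₁.
ContinuumHypothesis : Set₁
ContinuumHypothesis =
  Σ[ W ∈ StrictTotalOrder 0ℓ 0ℓ 0ℓ ]
    HasOrderTypeω₁ W × Bijection (StrictTotalOrder.Eq.setoid W) (ℕ →-setoid Bool)

------------------------------------------------------------------------
-- Abelian groups

Ab : Set₁
Ab = AbelianGroup 0ℓ 0ℓ

∣_∣ : Ab → Set
∣ A ∣ = AbelianGroup.Carrier A

record Subgroup (A : Ab) : Set₁ where
  open AbelianGroup A hiding (refl; sym; trans; setoid; group)
  field
    Member    : Pred Carrier 0ℓ
    resp      : Member Respects _≈_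
    ε-closed  : Member ε
    ∙-closed  : ∀ {x y} → Member x → Member y → Member (x ∙ y)
    ⁻¹-closed : ∀ {x} → Member x → Member (x ⁻¹)

  group : Ab
  group = record
    { Carrier = Σ Carrier Member
    ; _≈_     = λ x y → proj₁ x ≈ proj₁ y
    ; _∙_     = λ (x , x∈) (y , y∈) → x ∙ y , ∙-closed x∈ y∈
    ; ε       = ε , ε-closed
    ; _⁻¹     = λ (x , x∈) → x ⁻¹ , ⁻¹-closed x∈
    ; isAbelianGroup = record
      { isGroup = record
        { isMonoid = record
          { isSemigroup = record
            { isMagma = record
              { isEquivalence = On.isEquivalence proj₁ isEquivalence
              ; ∙-cong        = ∙-cong
              }
            ; assoc = λ _ _ _ → assoc _ _ _
            }
          ; identity = (λ _ → identityˡ _) , (λ _ → identityʳ _)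
          }
        ; inverse = (λ _ → inverseˡ _) , (λ _ → inverseʳ _)
        ; ⁻¹-cong = ⁻¹-cong
        }
      ; comm = λ _ _ → comm _ _
      }
    }

open Subgroup public using (Member)

module _ (A : Ab) where
  open AbelianGroup A hiding (refl; sym; trans; setoid)
  private module A = AbelianGroup A
  open AbelianGroupProperties A
  open Mult commutativeMonoid using (×-distrib-+; ×-congʳ) renaming (_×_ to _×ₙ_)
  open CommutativeSemigroupProperties commutativeSemigroup using (interchange)
  open SetoidReasoning A.setoid

  multiple : ℤ → Carrier → Carrier
  multiple (+ n)    x = n ×ₙ x
  multiple -[1+ n ] x = (suc n ×ₙ x) ⁻¹

  multiples : ℤ → Pred Carrier 0ℓ → Pred Carrier 0ℓ
  multiples z H x = ∃[ h ] (H h × x ≈ multiple z h)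

  -- For a subgroup H contained in the subgroup K.
  IsPure : Pred Carrier 0ℓ → Pred Carrier 0ℓ → Set
  IsPure H K = ∀ z → (H ∩ multiples z K) ≐ multiples z H

  IsDivisible : Pred Carrier 0ℓ → Set
  IsDivisible H = ∀ n → H ⊆ multiples (+ suc n) H

  IsMaximalDivisible : Subgroup A → Set₁
  IsMaximalDivisible M =
    IsDivisible (Member M) ×
    (∀ (H : Subgroup A) → IsDivisible (Member H) → Member H ⊆ Member M)

  IsInternalDirectSum : Pred Carrier 0ℓ → Pred Carrier 0ℓ → Set
  IsInternalDirectSum H K =
    (∀ a → ∃[ h ] ∃[ k ] (H h × K k × a ≈ h ∙ k)) ×
    (∀ a → H a → K a → a ≈ ε)

  IsIndependent : ∀ {n} → Vector Carrier n → Set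
  IsIndependent {n} v =
    (c : Vector ℤ n) → sum rawMonoid (λ i → multiple (c i) (v i)) ≈ ε → ∀ i → c i ≡ ℤ.0ℤ

  -- n is the cardinality of a maximal independent system.
  HasRank : ℕ → Set
  HasRank n = Σ[ v ∈ Vector Carrier n ] (IsIndependent v × (∀ a → ¬ IsIndependent (a ∷ v)))

  HasFiniteRank : Set
  HasFiniteRank = ∃ HasRank

  ×ₙ-⁻¹ : ∀ n x → n ×ₙ (x ⁻¹) ≈ (n ×ₙ x) ⁻¹
  ×ₙ-⁻¹ zero    x = A.sym ε⁻¹≈ε
  ×ₙ-⁻¹ (suc n) x = begin
    x ⁻¹ ∙ n ×ₙ (x ⁻¹)  ≈⟨ ∙-congˡ (×ₙ-⁻¹ n x) ⟩
    x ⁻¹ ∙ (n ×ₙ x) ⁻¹  ≈⟨ ⁻¹-∙-comm x (n ×ₙ x) ⟩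
    (x ∙ n ×ₙ x) ⁻¹     ∎

  -- The closure of H in the ℤ-adic topology, whose basic neighbourhoods of x
  -- are the cosets x + nA with n ≥ 1: each of them has to meet H.
  ℤ-adicClosure : Subgroup A → Subgroup A
  ℤ-adicClosure H = record
    { Member    = λ x → ∀ n → ∃[ y ] H.Member (x ∙ suc n ×ₙ y)
    ; resp      = λ x≈x′ x∈ n → let (y , h) = x∈ n in y , H.resp (∙-congʳ x≈x′) h
    ; ε-closed  = λ n → ε , H.resp (closed-ε n) H.ε-closed
    ; ∙-closed  = λ {x} {x′} x∈ x′∈ n →
        let (y , h) = x∈ n ; (y′ , h′) = x′∈ n in
        y ∙ y′ , H.resp (closed-∙ n x y x′ y′) (H.∙-closed h h′)
    ; ⁻¹-closed = λ {x} x∈ n → let (y , h) = x∈ n in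
        y ⁻¹ , H.resp (closed-⁻¹ n x y) (H.⁻¹-closed h)
    }
    where
    module H = Subgroup H

    ×ₙ-ε : ∀ n → n ×ₙ ε ≈ ε
    ×ₙ-ε zero    = A.refl
    ×ₙ-ε (suc n) = A.trans (identityˡ _) (×ₙ-ε n)

    closed-ε : ∀ n → ε ≈ ε ∙ suc n ×ₙ ε
    closed-ε n = A.sym (A.trans (identityˡ _) (×ₙ-ε (suc n)))

    closed-∙ : ∀ n x y x′ y′ →
               (x ∙ suc n ×ₙ y) ∙ (x′ ∙ suc n ×ₙ y′) ≈ (x ∙ x′) ∙ suc n ×ₙ (y ∙ y′)
    closed-∙ n x y x′ y′ = begin
      (x ∙ suc n ×ₙ y) ∙ (x′ ∙ suc n ×ₙ y′)  ≈⟨ interchange _ _ _ _ ⟩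
      (x ∙ x′) ∙ (suc n ×ₙ y ∙ suc n ×ₙ y′)  ≈⟨ ∙-congˡ (×-distrib-+ y y′ (suc n)) ⟨
      (x ∙ x′) ∙ suc n ×ₙ (y ∙ y′)           ∎

    closed-⁻¹ : ∀ n x y → (x ∙ suc n ×ₙ y) ⁻¹ ≈ x ⁻¹ ∙ suc n ×ₙ (y ⁻¹)
    closed-⁻¹ n x y = begin
      (x ∙ suc n ×ₙ y) ⁻¹        ≈⟨ ⁻¹-∙-comm _ _ ⟨
      x ⁻¹ ∙ (suc n ×ₙ y) ⁻¹     ≈⟨ ∙-congˡ (×ₙ-⁻¹ (suc n) y) ⟨
      x ⁻¹ ∙ suc n ×ₙ (y ⁻¹)     ∎

  Quotient : Subgroup A → Ab
  Quotient N = record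
    { Carrier = Carrier
    ; _≈_     = _≈N_
    ; _∙_     = _∙_
    ; ε       = ε
    ; _⁻¹     = _⁻¹
    ; isAbelianGroup = record
      { isGroup = record
        { isMonoid = record
          { isSemigroup = record
            { isMagma = record
              { isEquivalence = record
                { refl  = ≈⇒≈N A.refl
                ; sym   = λ {x} {y} h → N.resp (⁻¹-anti-homo‿- x y) (N.⁻¹-closed h)
                ; trans = λ {x} {y} {z} h k → N.resp (telescope x y z) (N.∙-closed h k)
                }
              ; ∙-cong = λ {x} {y} {u} {v} h k → N.resp (sum-diff x y u v) (N.∙-closed h k)
              }
            ; assoc = λ x y z → ≈⇒≈N (assoc x y z)
            }
          ; identity = (λ x → ≈⇒≈N (identityˡ x)) , (λ x → ≈⇒≈N (identityʳ x))
          }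
        ; inverse = (λ x → ≈⇒≈N (inverseˡ x)) , (λ x → ≈⇒≈N (inverseʳ x))
        ; ⁻¹-cong = λ {x} {y} h → N.resp (A.sym (⁻¹-∙-comm x (y ⁻¹))) (N.⁻¹-closed h)
        }
      ; comm = λ x y → ≈⇒≈N (comm x y)
      }
    }
    where
    module N = Subgroup N

    _≈N_ : Rel Carrier 0ℓ
    x ≈N y = N.Member (x - y)

    ≈⇒≈N : ∀ {x y} → x ≈ y → x ≈N y
    ≈⇒≈N x≈y = N.resp (A.sym (x≈y⇒x∙y⁻¹≈ε x≈y)) N.ε-closed

    telescope : ∀ x y z → (x - y) ∙ (y - z) ≈ x - z
    telescope x y z = begin
      (x - y) ∙ (y - z)      ≈⟨ assoc x (y ⁻¹) (y - z) ⟩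
      x ∙ (y ⁻¹ ∙ (y - z))   ≈⟨ ∙-congˡ (\\-leftDividesʳ y (z ⁻¹)) ⟩
      x - z                  ∎

    sum-diff : ∀ x y u v → (x - y) ∙ (u - v) ≈ (x ∙ u) - (y ∙ v)
    sum-diff x y u v = A.trans (interchange _ _ _ _) (∙-congˡ (⁻¹-∙-comm y v))

-- The additive group of homomorphisms.
Hom : Ab → Ab → Ab
Hom A B = record
  { Carrier = GroupHomomorphism A.rawGroup B.rawGroup
  ; _≈_     = λ φ ψ → ∀ x → ⟦ φ ⟧ x B.≈ ⟦ ψ ⟧ x
  ; _∙_     = λ φ ψ → hom (λ x → ⟦ φ ⟧ x B.∙ ⟦ ψ ⟧ x)
      (λ x≈y → B.∙-cong (⟦⟧-cong φ x≈y) (⟦⟧-cong ψ x≈y))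
      (λ x y → B.trans (B.∙-cong (homo φ x y) (homo ψ x y)) (interchange _ _ _ _))
      (B.trans (B.∙-cong (ε-homo φ) (ε-homo ψ)) (B.identityˡ _))
      (λ x → B.trans (B.∙-cong (⁻¹-homo φ x) (⁻¹-homo ψ x)) (⁻¹-∙-comm _ _))
  ; ε       = hom (λ _ → B.ε)
      (λ _ → B.refl) (λ _ _ → B.sym (B.identityˡ _)) B.refl (λ _ → B.sym ε⁻¹≈ε)
  ; _⁻¹     = λ φ → hom (λ x → ⟦ φ ⟧ x B.⁻¹)
      (λ x≈y → B.⁻¹-cong (⟦⟧-cong φ x≈y))
      (λ x y → B.trans (B.⁻¹-cong (homo φ x y)) (B.sym (⁻¹-∙-comm _ _)))
      (B.trans (B.⁻¹-cong (ε-homo φ)) ε⁻¹≈ε)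
      (λ x → B.⁻¹-cong (⁻¹-homo φ x))
  ; isAbelianGroup = record
    { isGroup = record
      { isMonoid = record
        { isSemigroup = record
          { isMagma = record
            { isEquivalence = record
              { refl  = λ _ → B.refl
              ; sym   = λ φ≈ψ x → B.sym (φ≈ψ x)
              ; trans = λ φ≈ψ ψ≈χ x → B.trans (φ≈ψ x) (ψ≈χ x)
              }
            ; ∙-cong = λ φ≈φ′ ψ≈ψ′ x → B.∙-cong (φ≈φ′ x) (ψ≈ψ′ x)
            }
          ; assoc = λ _ _ _ _ → B.assoc _ _ _
          }
        ; identity = (λ _ _ → B.identityˡ _) , (λ _ _ → B.identityʳ _)
        }
      ; inverse = (λ _ _ → B.inverseˡ _) , (λ _ _ → B.inverseʳ _)
      ; ⁻¹-cong = λ φ≈ψ x → B.⁻¹-cong (φ≈ψ x)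
      }
    ; comm = λ _ _ _ → B.comm _ _
    }
  }
  where
  module A = AbelianGroup A
  module B = AbelianGroup B
  open GroupHomomorphism
  open AbelianGroupProperties B using (⁻¹-∙-comm; ε⁻¹≈ε)
  open CommutativeSemigroupProperties B.commutativeSemigroup using (interchange)

  hom : (f : A.Carrier → B.Carrier) →
        (∀ {x y} → x A.≈ y → f x B.≈ f y) →
        (∀ x y → f (x A.∙ y) B.≈ (f x B.∙ f y)) →
        f A.ε B.≈ B.ε →
        (∀ x → f (x A.⁻¹) B.≈ (f x B.⁻¹)) →
        GroupHomomorphism A.rawGroup B.rawGroup
  hom f f-cong f-∙ f-ε f-⁻¹ = record
    { ⟦_⟧ = f
    ; isGroupHomomorphism = record
      { isMonoidHomomorphism = record
        { isMagmaHomomorphism = record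
          { isRelHomomorphism = record { cong = f-cong }
          ; homo = f-∙
          }
        ; ε-homo = f-ε
        }
      ; ⁻¹-homo = f-⁻¹
      }
    }

Image : (A B : Ab) → ∣ Hom A B ∣ → Subgroup B
Image A B φ = record
  { Member    = λ y → ∃[ x ] ⟦ x ⟧ ≈ y
  ; resp      = λ y≈y′ (x , e) → x , B.trans e y≈y′
  ; ε-closed  = A.ε , ε-homo
  ; ∙-closed  = λ (x , e) (x′ , e′) → x A.∙ x′ , B.trans (homo x x′) (∙-cong e e′)
  ; ⁻¹-closed = λ (x , e) → x A.⁻¹ , B.trans (⁻¹-homo x) (⁻¹-cong e)
  }
  where
  module A = AbelianGroup A
  module B = AbelianGroup B
  open B using (_≈_; ∙-cong; ⁻¹-cong)
  open GroupHomomorphism φ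

-- The endomorphism ring, as an additive group.
End : Ab → Ab
End G = Hom G G

Scalar : (G : Ab) → Pred ∣ End G ∣ 0ℓ
Scalar G φ = ∃[ z ] ∀ x → ⟦ x ⟧ ≈ multiple G z x
  where
  open AbelianGroup G using (_≈_)
  open GroupHomomorphism φ

Fin : (G : Ab) → Pred ∣ End G ∣ 0ℓ
Fin G φ = HasFiniteRank (Subgroup.group (Image G G φ))

ℤ-group : Ab
ℤ-group = ℤ.+-0-abelianGroup

Dual : Ab → Ab
Dual G = Hom G ℤ-group

------------------------------------------------------------------------
-- The Baer–Specker group

P : Ab
P = Pointwise.abelianGroup ℕ ℤ-group

S : Subgroup P
S = record
  { Member    = λ x → ∃[ N ] ∀ i → N ℕ.≤ i → x i ≡ ℤ.0ℤ
  ; resp      = λ x≈y (N , h) → N , λ i N≤i → trans (sym (x≈y i)) (h i N≤i)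
  ; ε-closed  = 0 , λ _ _ → refl
  ; ∙-closed  = λ {x} {y} (M , h) (N , k) → M ℕ.⊔ N , λ i l →
      trans (cong (ℤ._+ y i) (h i (ℕ.≤-trans (ℕ.m≤m⊔n M N) l)))
            (trans (ℤ.+-identityˡ (y i)) (k i (ℕ.≤-trans (ℕ.m≤n⊔m M N) l)))
  ; ⁻¹-closed = λ (N , h) → N , λ i N≤i → cong ℤ.-_ (h i N≤i)
  }

D : Subgroup P
D = ℤ-adicClosure P S

P/S : Ab
P/S = Quotient P S

private
  open AbelianGroup P hiding (refl; sym; trans; setoid)
  module P = AbelianGroup P
  module S = Subgroup S
  module D = Subgroup D
  open AbelianGroupProperties P
  open Mult commutativeMonoid using (×-distrib-+; ×-assocˡ) renaming (_×_ to _×ₙ_)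
  open SetoidReasoning P.setoid

-- D / S, as a subgroup of P / S with pre-image D.
D/S : Subgroup P/S
D/S = record
  { Member    = D.Member
  ; resp      = λ {x} {y} x-y∈S x∈D n → let (w , h) = x∈D n in
      w , S.resp (swap x y (suc n ×ₙ w)) (S.∙-closed (S.⁻¹-closed x-y∈S) h)
  ; ε-closed  = D.ε-closed
  ; ∙-closed  = λ {x} {y} → D.∙-closed {x} {y}
  ; ⁻¹-closed = λ {x} → D.⁻¹-closed {x}
  }
  where
  swap : ∀ x y w → (x - y) ⁻¹ ∙ (x ∙ w) ≈ y ∙ w
  swap x y w = begin
    (x - y) ⁻¹ ∙ (x ∙ w)    ≈⟨ ∙-congʳ {x ∙ w} (⁻¹-anti-homo‿- x y) ⟩
    (y - x) ∙ (x ∙ w)       ≈⟨ assoc y (x ⁻¹) (x ∙ w) ⟩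
    y ∙ (x ⁻¹ ∙ (x ∙ w))    ≈⟨ ∙-congˡ {y} (\\-leftDividesʳ x w) ⟩
    y ∙ w                   ∎

-- Hence D is also the pre-image of the maximal divisible subgroup of P / S.
D/S-isMaximalDivisible : IsMaximalDivisible P/S D/S
D/S-isMaximalDivisible = divisible , maximal
  where
  ×ₙ-pointwise : ∀ n x i → (n ×ₙ x) i ≡ + n ℤ.* x i
  ×ₙ-pointwise zero    x i = sym (ℤ.*-zeroˡ (x i))
  ×ₙ-pointwise (suc n) x i =
    trans (cong (λ t → x i ℤ.+ t) (×ₙ-pointwise n x i)) (sym (ℤ.suc-* (+ n) (x i)))

  S-pure : ∀ n x → S.Member (suc n ×ₙ x) → S.Member x
  S-pure n x (N , h) = N , λ i N≤i →
    ℤ.*-cancelˡ-≡ (+ suc n) (x i) ℤ.0ℤ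
      (trans (sym (×ₙ-pointwise (suc n) x i)) (trans (h i N≤i) (sym (ℤ.*-zeroʳ (+ suc n)))))

  -- Not definitional: the two sides are stuck on n and their relations differ.
  ×ₙ-P/S : ∀ n x → Mult._×_ (AbelianGroup.commutativeMonoid P/S) n x ≡ n ×ₙ x
  ×ₙ-P/S zero    x = refl
  ×ₙ-P/S (suc n) x = cong (x ∙_) (×ₙ-P/S n x)

  divisible : IsDivisible P/S D.Member
  divisible n {x} x∈D = y ⁻¹ , y⁻¹∈D ,
      subst (λ t → S.Member (x - t)) (sym (×ₙ-P/S (suc n) (y ⁻¹))) (S.resp eq₁ (proj₂ (x∈D n)))
    where
    y = proj₁ (x∈D n)

    eq₁ : x ∙ suc n ×ₙ y ≈ x - suc n ×ₙ (y ⁻¹)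
    eq₁ = ∙-congˡ {x} (begin
      suc n ×ₙ y             ≈⟨ ⁻¹-involutive (suc n ×ₙ y) ⟨
      ((suc n ×ₙ y) ⁻¹) ⁻¹   ≈⟨ ⁻¹-cong (×ₙ-⁻¹ P (suc n) y) ⟨
      (suc n ×ₙ (y ⁻¹)) ⁻¹   ∎)

    y⁻¹∈D : D.Member (y ⁻¹)
    y⁻¹∈D m = z , S-pure n (y ⁻¹ ∙ suc m ×ₙ z)
        (S.resp eq₂ (S.∙-closed (S.⁻¹-closed (proj₂ (x∈D n))) (proj₂ (x∈D k))))
      where
      k = m ℕ.+ n ℕ.* suc m
      z = proj₁ (x∈D k)
      Y = suc n ×ₙ y
      Z = suc k ×ₙ z

      eq₂ : (x ∙ Y) ⁻¹ ∙ (x ∙ Z) ≈ suc n ×ₙ (y ⁻¹ ∙ suc m ×ₙ z)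
      eq₂ = begin
        (x ∙ Y) ⁻¹ ∙ (x ∙ Z)                       ≈⟨ ∙-congʳ {x ∙ Z} (⁻¹-anti-homo-∙ x Y) ⟩
        (Y ⁻¹ ∙ x ⁻¹) ∙ (x ∙ Z)                    ≈⟨ assoc (Y ⁻¹) (x ⁻¹) (x ∙ Z) ⟩
        Y ⁻¹ ∙ (x ⁻¹ ∙ (x ∙ Z))                    ≈⟨ ∙-congˡ {Y ⁻¹} (\\-leftDividesʳ x Z) ⟩
        Y ⁻¹ ∙ Z                                   ≈⟨ ∙-cong {suc n ×ₙ (y ⁻¹)} {Y ⁻¹} (×ₙ-⁻¹ P (suc n) y) (×-assocˡ z (suc n) (suc m)) ⟨
        suc n ×ₙ (y ⁻¹) ∙ suc n ×ₙ (suc m ×ₙ z)    ≈⟨ ×-distrib-+ (y ⁻¹) (suc m ×ₙ z) (suc n) ⟨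
        suc n ×ₙ (y ⁻¹ ∙ suc m ×ₙ z)               ∎

  maximal : ∀ (H : Subgroup P/S) → IsDivisible P/S (Member H) → Member H ⊆ D.Member
  maximal H H-div {x} x∈H n = let (y , _ , h) = H-div n x∈H in
    y ⁻¹ , S.resp (∙-congˡ {x} (P.sym {suc n ×ₙ (y ⁻¹)} (×ₙ-⁻¹ P (suc n) y)))
      (subst (λ t → S.Member (x - t)) (×ₙ-P/S (suc n) y) h)

{-# OPTIONS --safe #-}

-- Functionals on a pure subgroup of D containing S are the pairings
-- x ↦ Σ bᵢ xᵢ with sequences b (the series converges ℤ-adically).  So G consists
-- of the x in D whose pairings with certain b_α, α < ω₁, are integers, and
-- vectors x_α ∈ G are constructed along with the b_α.  At stage α one considers
-- the α-th matrix M, as a candidate for an endomorphism of G.  A generic x_α,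
-- integral with respect to the earlier b_β, has its image M x_α outside the pure
-- subgroup generated by S and the x_β with β ≤ α; hence a generic b_α is integral
-- on that subgroup but not at M x_α, which keeps M x_α out of G.  This can only
-- fail if for some k ≠ 0 and l the kernel of k M − l has finite corank, in which
-- case k divides l and M is almost scalar.  Since the b_α are also chosen
-- pairwise distinct, G* is uncountable.
module Submission where

open import Defs
open import Algebra.Bundles using (AbelianGroup)
open import Algebra.Definitions.RawMonoid using (sum)
open import Algebra.Morphism.Bundles using (GroupHomomorphism)
open import Axiom.ExcludedMiddle using (ExcludedMiddle)
open import Data.Bool.Base using (Bool; true)
open import Data.Fin.Base as Fin using (punchIn; punchOut; fromℕ<; toℕ; splitAt; join)
import Data.Fin.Properties as Fin
open import Data.Integer.Base as ℤ using (ℤ; +_; -[1+_]; 0ℤ; 1ℤ; -1ℤ; _+_; _*_; _-_; -_)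
import Data.Integer.DivMod as ℤ
open import Data.Integer.Divisibility.Signed
open import Data.Integer.Properties
open import Data.Integer.Tactic.RingSolver
open import Data.List.Base using ([]; _∷_)
open import Data.Maybe.Base using (Maybe; just; nothing)
open import Data.Nat.Base as ℕ using (ℕ; zero; suc)
import Data.Nat.Divisibility as ℕ
open import Data.Nat.Induction using (<-rec)
import Data.Nat.Properties as ℕ
open import Data.Product.Base using (Σ-syntax; ∃-syntax; _×_; _,_; proj₁; proj₂)
open import Data.Sum.Base using (_⊎_; inj₁; inj₂; [_,_]′)
open import Data.Vec.Functional as Vector using (Vector)
open import Function.Base using (_∘_; case_of_)
open import Function.Bundles using (Bijection; Func; Injection)
open import Induction.WellFounded using (Acc; acc)
open import Level using (0ℓ)
open import Relation.Binary.Bundles using (Setoid; StrictTotalOrder)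
open import Relation.Binary.Definitions using (Tri; tri<; tri≈; tri>)
open import Relation.Binary.PropositionalEquality hiding (J)
open import Relation.Nullary using (¬_; Dec; yes; no; does; contradiction)
open import Relation.Nullary.Decidable using (¬?; dec-true; decidable-stable)
open import Relation.Unary using (_⊆_; U)

-- The continuum hypothesis gives every matrix a stage with only countably many predecessors. That
-- is as much as genericity can bear: a sequence is built in ω steps from finite approximations,
-- each step treating one requirement and respecting finitely many commitments. A pairing is kept
-- away from an integer ℤ-adically: once the current value differs from it, all later changes are
-- divisible by an integer that does not divide the difference.
--
-- A stage cannot know G, since later b's still cut it down. So the candidates are arbitrary
-- matrices, and what is secured is that M x_α does not survive, whatever G becomes. Membership in a
-- pure subgroup involves denominators, which is why the obstruction concerns k M - l and not M - l;
-- S is disregarded by looking only at coordinates from some point on. The obstruction is a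
-- dependence on finitely many of the b's because a single step respects only finitely many
-- commitments.

*-≢0 : ∀ {i j} → i ≢ 0ℤ → j ≢ 0ℤ → i * j ≢ 0ℤ
*-≢0 {i} i≢0 j≢0 eq = [ i≢0 , j≢0 ]′ (i*j≡0⇒i≡0∨j≡0 i eq)

*-cancelˡ-≡0 : ∀ {i j} → i ≢ 0ℤ → i * j ≡ 0ℤ → j ≡ 0ℤ
*-cancelˡ-≡0 {i} i≢0 eq = [ (λ p → contradiction p i≢0) , (λ q → q) ]′ (i*j≡0⇒i≡0∨j≡0 i eq)

cancel-∣ : ∀ {k i j} → k ≢ 0ℤ → k * i ∣ k * j → i ∣ j
cancel-∣ {k} k≢0 = *-cancelˡ-∣ k {{ℤ.≢-nonZero k≢0}}

∣-cong : ∀ {d i j} → i ≡ j → d ∣ i → d ∣ j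
∣-cong refl p = p

∣0 : ∀ {d} → d ∣ 0ℤ
∣0 {d} = divides 0ℤ refl

-- Too large to divide `c` unless `c` is 0. It turns `c ≠ 0` into a failure of divisibility, which
-- survives ℤ-adic approximation.
beyond : ℤ → ℤ
beyond c = + suc ℤ.∣ c ∣

beyond≢0 : ∀ {c} → beyond c ≢ 0ℤ
beyond≢0 ()

beyond∣⇒≡0 : ∀ {c} → beyond c ∣ c → c ≡ 0ℤ
beyond∣⇒≡0 {c} p with ℤ.∣ c ∣ in eq | ∣⇒∣ᵤ p
... | zero  | _ = ∣i∣≡0⇒i≡0 eq
... | suc n | q = contradiction (ℕ.∣⇒≤ q) ℕ.1+n≰n

-- Partial sums and ℤ-adic limits

Σ< : ℕ → (ℕ → ℤ) → ℤ
Σ< zero    f = 0ℤ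
Σ< (suc n) f = Σ< n f + f n

Σ<-cong : ∀ n {f g} → (∀ i → i ℕ.< n → f i ≡ g i) → Σ< n f ≡ Σ< n g
Σ<-cong zero    f≗g = refl
Σ<-cong (suc n) f≗g =
  cong₂ _+_ (Σ<-cong n λ i i<n → f≗g i (ℕ.m<n⇒m<1+n i<n)) (f≗g n (ℕ.n<1+n n))

Σ<-zero : ∀ n {f} → (∀ i → i ℕ.< n → f i ≡ 0ℤ) → Σ< n f ≡ 0ℤ
Σ<-zero zero    f≗0 = refl
Σ<-zero (suc n) f≗0 =
  cong₂ _+_ (Σ<-zero n λ i i<n → f≗0 i (ℕ.m<n⇒m<1+n i<n)) (f≗0 n (ℕ.n<1+n n))

Σ<-linear : ∀ n p q f g → Σ< n (λ i → p * f i + q * g i) ≡ p * Σ< n f + q * Σ< n g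
Σ<-linear zero    p q f g = solve (p ∷ q ∷ [])
Σ<-linear (suc n) p q f g =
  trans (cong (_+ (p * f n + q * g n)) (Σ<-linear n p q f g)) (lemma p q (Σ< n f) (Σ< n g) (f n) (g n))
  where
  lemma : ∀ p q a b c d → p * a + q * b + (p * c + q * d) ≡ p * (a + c) + q * (b + d)
  lemma = solve-∀

Σ<-*ʳ : ∀ n c f → Σ< n (λ i → f i * c) ≡ Σ< n f * c
Σ<-*ʳ zero    c f = solve (c ∷ [])
Σ<-*ʳ (suc n) c f = trans (cong (_+ f n * c) (Σ<-*ʳ n c f)) (lemma (Σ< n f) (f n) c)
  where
  lemma : ∀ a b c → a * c + b * c ≡ (a + b) * c
  lemma = solve-∀

V : Set
V = ℕ → ℤ

δ : ℕ → V
δ zero    zero    = 1ℤ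
δ zero    (suc i) = 0ℤ
δ (suc j) zero    = 0ℤ
δ (suc j) (suc i) = δ j i

δ-diag : ∀ j → δ j j ≡ 1ℤ
δ-diag zero    = refl
δ-diag (suc j) = δ-diag j

δ-off : ∀ {j i} → j ≢ i → δ j i ≡ 0ℤ
δ-off {zero}  {zero}  j≢i = contradiction refl j≢i
δ-off {zero}  {suc i} j≢i = refl
δ-off {suc j} {zero}  j≢i = refl
δ-off {suc j} {suc i} j≢i = δ-off (j≢i ∘ cong suc)

δ-sym : ∀ i j → δ i j ≡ δ j i
δ-sym zero    zero    = refl
δ-sym zero    (suc j) = refl
δ-sym (suc i) zero    = refl
δ-sym (suc i) (suc j) = δ-sym i j

dot : V → V → ℕ → ℤ
dot b x m = Σ< m λ i → b i * x i

dot-comm : ∀ b x m → dot b x m ≡ dot x b m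
dot-comm b x m = Σ<-cong m λ i _ → *-comm (b i) (x i)

dot-congʳ : ∀ b {x y} m → (∀ i → i ℕ.< m → x i ≡ y i) → dot b x m ≡ dot b y m
dot-congʳ b m x≗y = Σ<-cong m λ i i<m → cong (b i *_) (x≗y i i<m)

dot-linearʳ : ∀ b p x q y m → dot b (λ i → p * x i + q * y i) m ≡ p * dot b x m + q * dot b y m
dot-linearʳ b p x q y m =
  trans (Σ<-cong m λ i _ → lemma (b i) p (x i) q (y i)) (Σ<-linear m p q _ _)
  where
  lemma : ∀ b p x q y → b * (p * x + q * y) ≡ p * (b * x) + q * (b * y)
  lemma = solve-∀

dot-zero : ∀ b {x} m → (∀ i → i ℕ.< m → x i ≡ 0ℤ) → dot b x m ≡ 0ℤ
dot-zero b m x≗0 = Σ<-zero m λ i i<m → trans (cong (b i *_) (x≗0 i i<m)) (*-zeroʳ (b i))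

dot-mod : ∀ {d} b x {m n} → m ℕ.≤ n → (∀ i → m ℕ.≤ i → i ℕ.< n → d ∣ x i) → d ∣ dot b x n - dot b x m
dot-mod {d} b x m≤n = go (ℕ.≤⇒≤′ m≤n)
  where
  lemma : ∀ a b c → a - b + c ≡ a + c - b
  lemma = solve-∀
  go : ∀ {m n} → m ℕ.≤′ n → (∀ i → m ℕ.≤ i → i ℕ.< n → d ∣ x i) → d ∣ dot b x n - dot b x m
  go {m} (ℕ.≤′-reflexive refl) h = ∣-cong (sym (+-inverseʳ (dot b x m))) ∣0
  go {m} (ℕ.≤′-step {n} m≤n) h = ∣-cong (lemma (dot b x n) (dot b x m) (b n * x n))
    (∣m∣n⇒∣m+n (go m≤n λ i m≤i i<n → h i m≤i (ℕ.m<n⇒m<1+n i<n))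
               (∣n⇒∣m*n (b n) (h n (ℕ.≤′⇒≤ m≤n) (ℕ.n<1+n n))))

dot-stable : ∀ b x {m n} → m ℕ.≤ n → (∀ i → m ℕ.≤ i → i ℕ.< n → x i ≡ 0ℤ) → dot b x n ≡ dot b x m
dot-stable b x m≤n x≗0 = i-j≡0⇒i≡j _ _
  (0∣⇒≡0 (dot-mod b x m≤n λ i m≤i i<n → ∣-cong (sym (x≗0 i m≤i i<n)) ∣-refl))

dot-δ : ∀ b {j m} → j ℕ.< m → dot b (δ j) m ≡ b j
dot-δ b {j} {m} j<m = begin
  dot b (δ j) m         ≡⟨ dot-stable b (δ j) j<m (λ i j<i _ → δ-off (ℕ.<⇒≢ j<i)) ⟩
  dot b (δ j) j + b j * δ j j
    ≡⟨ cong₂ _+_ (dot-zero b j λ i i<j → δ-off (ℕ.<⇒≢ i<j ∘ sym)) (cong (b j *_) (δ-diag j)) ⟩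
  0ℤ + b j * 1ℤ         ≡⟨ trans (+-identityˡ _) (*-identityʳ _) ⟩
  b j                   ∎
  where open ≡-Reasoning

-- Convergence to 0 in the ℤ-adic topology. For the entries of a vector of `P` it amounts to
-- membership in `D`; applied to partial sums minus a constant it expresses the convergence of a
-- series.
Null : V → Set
Null x = ∀ d → d ≢ 0ℤ → ∃[ N ] ∀ i → N ℕ.≤ i → d ∣ x i

Null-cong : ∀ {x y} → (∀ i → x i ≡ y i) → Null x → Null y
Null-cong x≗y x→0 d d≢0 = let (N , h) = x→0 d d≢0 in N , λ i N≤i → ∣-cong (x≗y i) (h i N≤i)

Null-linear : ∀ p q {x y} → Null x → Null y → Null (λ i → p * x i + q * y i)
Null-linear p q x→0 y→0 d d≢0 =
  let (M , h) = x→0 d d≢0 ; (N , k) = y→0 d d≢0 in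
  M ℕ.⊔ N , λ i l → ∣m∣n⇒∣m+n
    (∣n⇒∣m*n p (h i (ℕ.≤-trans (ℕ.m≤m⊔n M N) l)))
    (∣n⇒∣m*n q (k i (ℕ.≤-trans (ℕ.m≤n⊔m M N) l)))

Null-cancel : ∀ {k x} → k ≢ 0ℤ → Null (λ i → k * x i) → Null x
Null-cancel {k} k≢0 kx→0 d d≢0 =
  let (N , h) = kx→0 (k * d) (*-≢0 k≢0 d≢0) in N , λ i N≤i → cancel-∣ k≢0 (h i N≤i)

Null-const : ∀ {c} → Null (λ _ → c) → c ≡ 0ℤ
Null-const {c} c→0 =
  let (N , h) = c→0 (beyond c) (beyond≢0 {c}) in beyond∣⇒≡0 (h N ℕ.≤-refl)

Null-eventually : ∀ {x} N → (∀ i → N ℕ.≤ i → x i ≡ 0ℤ) → Null x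
Null-eventually N x≗0 d d≢0 = N , λ i N≤i → ∣-cong (sym (x≗0 i N≤i)) ∣0

-- The series Σ bᵢ xᵢ converges to the integer z in the ℤ-adic topology.
record Pairs (b x : V) (z : ℤ) : Set where
  constructor pairs
  field limit : Null λ m → dot b x m - z

open Pairs

Pairs-unique : ∀ {b x z z′} → Pairs b x z → Pairs b x z′ → z ≡ z′
Pairs-unique {b} {x} {z} {z′} p p′ = sym (i-j≡0⇒i≡j z′ z
  (Null-const (Null-cong (λ m → lemma (dot b x m) z z′) (Null-linear 1ℤ -1ℤ (limit p) (limit p′)))))
  where
  lemma : ∀ s z z′ → 1ℤ * (s - z) + -1ℤ * (s - z′) ≡ z′ - z
  lemma = solve-∀

Pairs-sym : ∀ {b x z} → Pairs b x z → Pairs x b z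
Pairs-sym {b} {x} {z} p = pairs (Null-cong (λ m → cong (_- z) (dot-comm b x m)) (limit p))

Pairs-congʳ : ∀ {b x y z} → (∀ i → x i ≡ y i) → Pairs b x z → Pairs b y z
Pairs-congʳ {b} {z = z} x≗y p =
  pairs (Null-cong (λ m → cong (_- z) (dot-congʳ b m λ i _ → x≗y i)) (limit p))

Pairs-congˡ : ∀ {a b x z} → (∀ i → a i ≡ b i) → Pairs a x z → Pairs b x z
Pairs-congˡ a≗b p = Pairs-sym (Pairs-congʳ a≗b (Pairs-sym p))

-- Lets `a` and `b` differ wherever `x` vanishes, so relations that hold only from some column on
-- become usable.
Pairs-termwise : ∀ {a b x z} → (∀ i → a i * x i ≡ b i * x i) → Pairs a x z → Pairs b x z
Pairs-termwise {z = z} eq (pairs p) = pairs (Null-cong (λ m → cong (_- z) (Σ<-cong m λ i _ → eq i)) p)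

Pairs-linearʳ : ∀ {b x y z w} p q → Pairs b x z → Pairs b y w →
                Pairs b (λ i → p * x i + q * y i) (p * z + q * w)
Pairs-linearʳ {b} {x} {y} {z} {w} p q h k = pairs (Null-cong
  (λ m → trans (lemma p q (dot b x m) (dot b y m) z w)
               (cong (_- (p * z + q * w)) (sym (dot-linearʳ b p x q y m))))
  (Null-linear p q (limit h) (limit k)))
  where
  lemma : ∀ p q s t z w → p * (s - z) + q * (t - w) ≡ (p * s + q * t) - (p * z + q * w)
  lemma = solve-∀

Pairs-linearˡ : ∀ {a b x z w} p q → Pairs a x z → Pairs b x w →
                Pairs (λ i → p * a i + q * b i) x (p * z + q * w)
Pairs-linearˡ p q h k = Pairs-sym (Pairs-linearʳ p q (Pairs-sym h) (Pairs-sym k))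

Pairs-zeroʳ : ∀ {b x} → (∀ i → x i ≡ 0ℤ) → Pairs b x 0ℤ
Pairs-zeroʳ {b} {x} x≗0 =
  pairs (Null-eventually 0 λ m _ → cong (_- 0ℤ) (dot-zero b m λ i _ → x≗0 i))

Pairs-zeroˡ : ∀ {b x} → (∀ i → b i ≡ 0ℤ) → Pairs b x 0ℤ
Pairs-zeroˡ b≗0 = Pairs-sym (Pairs-zeroʳ b≗0)

Pairs-finite : ∀ {b x} N → (∀ i → N ℕ.≤ i → x i ≡ 0ℤ) → Pairs b x (dot b x N)
Pairs-finite {b} {x} N x≗0 = pairs (Null-eventually N λ m N≤m →
  i≡j⇒i-j≡0 (dot-stable b x N≤m λ i N≤i _ → x≗0 i N≤i))

Pairs-δʳ : ∀ b j → Pairs b (δ j) (b j)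
Pairs-δʳ b j = subst (Pairs b (δ j)) (dot-δ b (ℕ.n<1+n j))
  (Pairs-finite (suc j) λ i j<i → δ-off (ℕ.<⇒≢ j<i))

Pairs-Σ : ∀ {x} n (c : ℕ → ℤ) {B : ℕ → V} {z : ℕ → ℤ} → (∀ t → Pairs (B t) x (z t)) →
          Pairs (λ i → Σ< n λ t → c t * B t i) x (Σ< n λ t → c t * z t)
Pairs-Σ zero    c         h = Pairs-zeroˡ λ _ → refl
Pairs-Σ (suc n) c {B} {z} h =
  subst (Pairs _ _) (1* (Σ< n λ t → c t * z t) (c n * z n))
    (Pairs-congˡ (λ i → 1* (Σ< n λ t → c t * B t i) (c n * B n i))
      (Pairs-linearˡ 1ℤ (c n) (Pairs-Σ n c h) (h n)))
  where
  1* : ∀ a b → 1ℤ * a + b ≡ a + b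
  1* = solve-∀

-- k divides z because it divides almost all of the differences k s − z, with s a partial sum.
Pairs-divide : ∀ {b x k z} → k ≢ 0ℤ → Pairs b (λ i → k * x i) z → ∃[ w ] Pairs b x w
Pairs-divide {b} {x} {k} {z} k≢0 p = w , pairs (Null-cancel k≢0 (Null-cong step (limit p)))
  where
  comm : ∀ b k x → b * (k * x) ≡ b * x * k
  comm = solve-∀
  scale : ∀ m → dot b (λ i → k * x i) m ≡ k * dot b x m
  scale m = trans (Σ<-cong m λ i _ → comm (b i) k (x i))
    (trans (Σ<-*ʳ m k λ i → b i * x i) (*-comm _ k))
  k∣z : k ∣ z
  k∣z = let (N , h) = limit p k k≢0 in
    ∣-cong (lemma (k * dot b x N) z) (∣m∣n⇒∣m-n (∣m⇒∣m*n (dot b x N) ∣-refl)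
      (∣-cong (cong (_- z) (scale N)) (h N ℕ.≤-refl)))
    where
    lemma : ∀ s z → s - (s - z) ≡ z
    lemma = solve-∀
  w : ℤ
  w = quotient k∣z
  step : ∀ m → dot b (λ i → k * x i) m - z ≡ k * (dot b x m - w)
  step m = trans (cong₂ _-_ (scale m) (_∣_.equality k∣z)) (lemma k (dot b x m) w)
    where
    lemma : ∀ k s w → k * s - w * k ≡ k * (s - w)
    lemma = solve-∀

-- Linear algebra over ℤ

sumℤ : ∀ {n} → Vector ℤ n → ℤ
sumℤ = sum ℤ.+-0-rawMonoid

sumℤ-cong : ∀ {n} {f g : Vector ℤ n} → (∀ t → f t ≡ g t) → sumℤ f ≡ sumℤ g
sumℤ-cong {zero}  f≗g = refl
sumℤ-cong {suc n} f≗g = cong₂ _+_ (f≗g Fin.zero) (sumℤ-cong (f≗g ∘ Fin.suc))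

sumℤ-zero : ∀ {n} {f : Vector ℤ n} → (∀ t → f t ≡ 0ℤ) → sumℤ f ≡ 0ℤ
sumℤ-zero {zero}  f≗0 = refl
sumℤ-zero {suc n} f≗0 = cong₂ _+_ (f≗0 Fin.zero) (sumℤ-zero (f≗0 ∘ Fin.suc))

sumℤ-linear : ∀ {n} p q (f g : Vector ℤ n) → sumℤ (λ t → p * f t + q * g t) ≡ p * sumℤ f + q * sumℤ g
sumℤ-linear {zero}  p q f g = solve (p ∷ q ∷ [])
sumℤ-linear {suc n} p q f g = trans
    (cong₂ _+_ (refl {x = p * f Fin.zero + q * g Fin.zero}) (sumℤ-linear p q (f ∘ Fin.suc) (g ∘ Fin.suc)))
  (lemma p q (f Fin.zero) (g Fin.zero) (sumℤ (f ∘ Fin.suc)) (sumℤ (g ∘ Fin.suc)))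
  where
  lemma : ∀ p q c d a b → (p * c + q * d) + (p * a + q * b) ≡ p * (c + a) + q * (d + b)
  lemma = solve-∀

sumℤ-*ʳ : ∀ {n} (f : Vector ℤ n) c → sumℤ (λ t → f t * c) ≡ sumℤ f * c
sumℤ-*ʳ {zero}  f c = refl
sumℤ-*ʳ {suc n} f c = trans (cong (λ t → f Fin.zero * c + t) (sumℤ-*ʳ (f ∘ Fin.suc) c))
  (sym (*-distribʳ-+ c (f Fin.zero) (sumℤ (f ∘ Fin.suc))))

sumℤ-swap : ∀ {m n} (f : Fin.Fin m → Fin.Fin n → ℤ) →
            sumℤ (λ i → sumℤ (f i)) ≡ sumℤ (λ j → sumℤ λ i → f i j)
sumℤ-swap {zero}  {n} f = sym (sumℤ-zero {n} λ _ → refl)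
sumℤ-swap {suc m} {n} f = begin
  sumℤ (f Fin.zero) + sumℤ (λ i → sumℤ (f (Fin.suc i)))
      ≡⟨ cong (λ t → sumℤ (f Fin.zero) + t) (sumℤ-swap (f ∘ Fin.suc)) ⟩
  sumℤ (f Fin.zero) + sumℤ g                             ≡⟨ lemma (sumℤ (f Fin.zero)) (sumℤ g) ⟨
  1ℤ * sumℤ (f Fin.zero) + 1ℤ * sumℤ g                   ≡⟨ sumℤ-linear 1ℤ 1ℤ (f Fin.zero) g ⟨
  sumℤ (λ j → 1ℤ * f Fin.zero j + 1ℤ * g j)              ≡⟨ sumℤ-cong (λ j → lemma (f Fin.zero j) (g j)) ⟩
  sumℤ (λ j → f Fin.zero j + g j)                        ∎
  where
  open ≡-Reasoning
  g : Vector ℤ n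
  g j = sumℤ λ i → f (Fin.suc i) j
  lemma : ∀ a b → 1ℤ * a + 1ℤ * b ≡ a + b
  lemma = solve-∀

sumℤ-δ : ∀ {n} (c : Vector ℤ n) s → sumℤ (λ t → c t * δ (Fin.toℕ t) (Fin.toℕ s)) ≡ c s
sumℤ-δ {suc n} c Fin.zero = trans
  (cong₂ _+_ (refl {x = c Fin.zero * 1ℤ}) (sumℤ-zero λ t → *-zeroʳ (c (Fin.suc t))))
      (trans (+-identityʳ _) (*-identityʳ _))
sumℤ-δ {suc n} c (Fin.suc s) = trans
  (cong₂ _+_ (*-zeroʳ (c Fin.zero)) (sumℤ-δ (c ∘ Fin.suc) s)) (+-identityˡ _)

-- Fraction-free Gaussian elimination: a nonzero entry of the first column serves as pivot and
-- removes one row and one column; if the column is zero, the first unit vector is a solution.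
kernel-vector : ∀ n (F : Fin.Fin n → Fin.Fin (suc n) → ℤ) →
  Σ[ c ∈ Vector ℤ (suc n) ] (∃[ t ] c t ≢ 0ℤ) × (∀ i → sumℤ (λ t → c t * F i t) ≡ 0ℤ)
kernel-vector zero    F = (λ _ → 1ℤ) , (Fin.zero , λ ()) , λ ()
kernel-vector (suc n) F with Fin.any? (λ i → ¬? (F i Fin.zero ≟ 0ℤ))
... | no none = c , (Fin.zero , λ ()) , λ i → cong₂ _+_
        (trans (*-identityˡ _) (decidable-stable (F i Fin.zero ≟ 0ℤ) λ q → none (i , q)))
        (sumℤ-zero {f = λ t → 0ℤ * F i (Fin.suc t)} λ t → refl)
  where
  c : Vector ℤ (suc (suc n))
  c = 1ℤ Vector.∷ λ _ → 0ℤ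
... | yes (p , a≢0) = c , (Fin.suc t₀ , *-≢0 a≢0 ct₀≢0) , rows
  where
  a = F p Fin.zero
  F′ : Fin.Fin n → Fin.Fin (suc n) → ℤ
  F′ i t = a * F (punchIn p i) (Fin.suc t) - F (punchIn p i) Fin.zero * F p (Fin.suc t)
  IH = kernel-vector n F′
  c′ = proj₁ IH
  t₀ = proj₁ (proj₁ (proj₂ IH))
  ct₀≢0 = proj₂ (proj₁ (proj₂ IH))
  s : Fin.Fin (suc n) → ℤ
  s i = sumℤ λ t → c′ t * F i (Fin.suc t)
  -- Back substitution in the pivot row would divide by `a`; scaling the other unknowns by `a`
  -- avoids this.
  c : Vector ℤ (suc (suc n))
  c = (- s p) Vector.∷ λ t → a * c′ t

  tail : ∀ i → sumℤ (λ t → (a * c′ t) * F i (Fin.suc t)) ≡ a * s i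
  tail i = trans (sumℤ-cong λ t → lem a (c′ t) (F i (Fin.suc t)))
    (trans (sumℤ-linear a 0ℤ (λ t → c′ t * F i (Fin.suc t)) (λ _ → 0ℤ))
        (lem₂ a (s i) (sumℤ {suc n} λ _ → 0ℤ)))
    where
    lem : ∀ a c f → (a * c) * f ≡ a * (c * f) + 0ℤ * 0ℤ
    lem = solve-∀
    lem₂ : ∀ a s r → a * s + 0ℤ * r ≡ a * s
    lem₂ = solve-∀

  pivot : ∀ a s → - s * a + a * s ≡ 0ℤ
  pivot = solve-∀

  rows : ∀ i → sumℤ (λ t → c t * F i t) ≡ 0ℤ
  rows i with p Fin.≟ i
  ... | yes refl = trans (cong₂ _+_ (refl {x = - s p * a}) (tail p)) (pivot a (s p))
  ... | no p≢i = subst (λ i → - s p * F i Fin.zero + sumℤ (λ t → (a * c′ t) * F i (Fin.suc t)) ≡ 0ℤ)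
          (Fin.punchIn-punchOut p≢i) (row (punchOut p≢i))
    where
    row : ∀ r → - s p * F (punchIn p r) Fin.zero +
        sumℤ (λ t → (a * c′ t) * F (punchIn p r) (Fin.suc t)) ≡ 0ℤ
    row r = begin
      - s p * f + sumℤ (λ t → (a * c′ t) * F i′ (Fin.suc t)) ≡⟨ cong₂ _+_ (refl {x = - s p * f}) (tail i′) ⟩
      - s p * f + a * s i′                                   ≡⟨ lem₁ (s p) f a (s i′) ⟩
      a * s i′ + - f * s p
          ≡⟨ sumℤ-linear a (- f) (λ t → c′ t * F i′ (Fin.suc t)) (λ t → c′ t * F p (Fin.suc t)) ⟨
      sumℤ (λ t → a * (c′ t * F i′ (Fin.suc t)) + - f * (c′ t * F p (Fin.suc t)))
        ≡⟨ sumℤ-cong (λ t → lem₂ a (c′ t) (F i′ (Fin.suc t)) f (F p (Fin.suc t))) ⟩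
      sumℤ (λ t → c′ t * F′ r t)                             ≡⟨ proj₂ (proj₂ IH) r ⟩
      0ℤ                                                     ∎
      where
      open ≡-Reasoning
      i′ = punchIn p r
      f = F i′ Fin.zero
      lem₁ : ∀ sp f a s → - sp * f + a * s ≡ a * s + - f * sp
      lem₁ = solve-∀
      lem₂ : ∀ a c g f h → a * (c * g) + - f * (c * h) ≡ c * (a * g - f * h)
      lem₂ = solve-∀

override : ℕ → ℤ → (ℕ → ℤ) → ℕ → ℤ
override n a c i with i ℕ.≟ n
... | yes _ = a
... | no  _ = c i

override-≡ : ∀ n a c → override n a c n ≡ a
override-≡ n a c with n ℕ.≟ n
... | yes _   = refl
... | no  n≢n = contradiction refl n≢n

override-< : ∀ {n i} a c → i ℕ.< n → override n a c i ≡ c i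
override-< {n} {i} a c i<n with i ℕ.≟ n
... | yes refl = contradiction i<n ℕ.1+n≰n
... | no  _    = refl

-- Finitely supported vectors

-- The bound `m` allows adding such a vector to a sequence whose first `m` entries are already
-- final.
record Finite (m : ℕ) : Set where
  field
    vec   : V
    top   : ℕ
    below : ∀ i → i ℕ.< m → vec i ≡ 0ℤ
    above : ∀ i → top ℕ.≤ i → vec i ≡ 0ℤ

open Finite

infix 7 _∙ᶠ_
_∙ᶠ_ : ∀ {m} → V → Finite m → ℤ
w ∙ᶠ u = dot w (vec u) (top u)

∙ᶠ-stable : ∀ {m} w (u : Finite m) {n} → top u ℕ.≤ n → dot w (vec u) n ≡ w ∙ᶠ u
∙ᶠ-stable w u top≤n = dot-stable w (vec u) top≤n λ i top≤i _ → above u i top≤i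

comb : ∀ {m} → ℤ → Finite m → ℤ → Finite m → Finite m
comb p u q v = record
  { vec   = λ i → p * vec u i + q * vec v i
  ; top   = top u ℕ.⊔ top v
  ; below = λ i i<m → zeros (below u i i<m) (below v i i<m)
  ; above = λ i l → zeros (above u i (ℕ.m⊔n≤o⇒m≤o (top u) (top v) l))
      (above v i (ℕ.m⊔n≤o⇒n≤o (top u) (top v) l))
  }
  where
  zeros : ∀ {a b} → a ≡ 0ℤ → b ≡ 0ℤ → p * a + q * b ≡ 0ℤ
  zeros refl refl = solve (p ∷ q ∷ [])

∙ᶠ-linear : ∀ {m} w p (u : Finite m) q v → w ∙ᶠ comb p u q v ≡ p * (w ∙ᶠ u) + q * (w ∙ᶠ v)
∙ᶠ-linear w p u q v = trans (dot-linearʳ w p (vec u) q (vec v) (top u ℕ.⊔ top v))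
  (cong₂ (λ s t → p * s + q * t) (∙ᶠ-stable w u (ℕ.m≤m⊔n (top u) (top v)))
                                 (∙ᶠ-stable w v (ℕ.m≤n⊔m (top u) (top v))))

δᶠ : ∀ {m j} → m ℕ.≤ j → Finite m
δᶠ {m} {j} m≤j = record
  { vec   = δ j
  ; top   = suc j
  ; below = λ i i<m → δ-off {j} {i} λ { refl → ℕ.<⇒≱ i<m m≤j }
  ; above = λ i j<i → δ-off {j} {i} (ℕ.<⇒≢ j<i)
  }

∙ᶠ-δ : ∀ {m j} w (m≤j : m ℕ.≤ j) → w ∙ᶠ δᶠ m≤j ≡ w j
∙ᶠ-δ {j = j} w m≤j = dot-δ w (ℕ.n<1+n j)

zeroᶠ : ∀ {m} → Finite m
zeroᶠ = record { vec = λ _ → 0ℤ ; top = 0 ; below = λ _ _ → refl ; above = λ _ _ → refl }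

-- Rational dependence of functionals

module Classical (em : ∀ ℓ → ExcludedMiddle ℓ) where

  dne : {A : Set} → ¬ ¬ A → A
  dne = decidable-stable (em 0ℓ)

  ¬∀⇒∃¬ : {A : Set} {B : A → Set} → ¬ (∀ a → B a) → ∃[ a ] ¬ B a
  ¬∀⇒∃¬ ¬∀ = dne λ ¬∃ → ¬∀ λ a → dne λ ¬b → ¬∃ (a , ¬b)

  module _ {U : Set} (combine : ℤ → U → ℤ → U → U) where

    Linear : (U → ℤ) → Set
    Linear f = ∀ p u q v → f (combine p u q v) ≡ p * f u + q * f v

    functional-dependence : ∀ n (f : ℕ → U → ℤ) (h : U → ℤ) → (∀ i → Linear (f i)) → Linear h →
      (∀ u → (∀ i → i ℕ.< n → f i u ≡ 0ℤ) → h u ≡ 0ℤ) →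
      ∃[ k ] k ≢ 0ℤ × Σ[ c ∈ (ℕ → ℤ) ] (∀ u → k * h u ≡ Σ< n λ i → c i * f i u)
    functional-dependence zero f h f-lin h-lin ker =
      1ℤ , (λ ()) , (λ _ → 0ℤ) , λ u → trans (*-identityˡ (h u)) (ker u λ _ ())
    functional-dependence (suc n) f h f-lin h-lin ker
      with em 0ℓ {∃[ u ] (∀ i → i ℕ.< n → f i u ≡ 0ℤ) × f n u ≢ 0ℤ}
    ... | no none = k , k≢0 , override n 0ℤ c , λ u → trans (k*h u) (sym (sum≡ u))
      where
      ker′ : ∀ u → (∀ i → i ℕ.< n → f i u ≡ 0ℤ) → h u ≡ 0ℤ
      ker′ u z = ker u λ i i<1+n → case ℕ.m<1+n⇒m<n∨m≡n i<1+n of λ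
        { (inj₁ i<n) → z i i<n ; (inj₂ refl) → dne λ fn≢0 → none (u , z , fn≢0) }
      IH = functional-dependence n f h f-lin h-lin ker′
      k = proj₁ IH
      k≢0 = proj₁ (proj₂ IH)
      c = proj₁ (proj₂ (proj₂ IH))
      k*h = proj₂ (proj₂ (proj₂ IH))
      sum≡ : ∀ u → Σ< (suc n) (λ i → override n 0ℤ c i * f i u) ≡ Σ< n λ i → c i * f i u
      sum≡ u = trans (cong₂ _+_ (Σ<-cong n λ i i<n → cong (_* f i u) (override-< 0ℤ c i<n))
                                (cong (_* f n u) (override-≡ n 0ℤ c)))
                     (+-identityʳ _)
    ... | yes (u₀ , z₀ , a≢0) =
        k * a , *-≢0 k≢0 a≢0 , override n (k * b) c , λ u → trans (k*h u) (sym (sum≡ u))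
      where
      a = f n u₀
      b = h u₀
      h′ : U → ℤ
      h′ u = a * h u + - b * f n u
      h′-lin : Linear h′
      h′-lin p u q v = trans (cong₂ (λ s t → a * s + - b * t) (h-lin p u q v) (f-lin n p u q v))
        (lemma a b p q (h u) (h v) (f n u) (f n v))
        where
        lemma : ∀ a b p q hu hv fu fv →
          a * (p * hu + q * hv) + - b * (p * fu + q * fv) ≡ p * (a * hu + - b * fu) + q * (a * hv + - b * fv)
        lemma = solve-∀
      ker′ : ∀ u → (∀ i → i ℕ.< n → f i u ≡ 0ℤ) → h′ u ≡ 0ℤ
      ker′ u z = begin
        a * h u + - b * f n u        ≡⟨ lemma₁ a (h u) b (f n u) ⟩
        a * h u + - f n u * b        ≡⟨ h-lin a u (- f n u) u₀ ⟨
        h (combine a u (- f n u) u₀) ≡⟨ ker _ vanish ⟩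
        0ℤ                           ∎
        where
        open ≡-Reasoning
        lemma₁ : ∀ a hu b fu → a * hu + - b * fu ≡ a * hu + - fu * b
        lemma₁ = solve-∀
        lemma₂ : ∀ a fu → a * fu + - fu * a ≡ 0ℤ
        lemma₂ = solve-∀
        lemma₃ : ∀ a b → a * 0ℤ + b * 0ℤ ≡ 0ℤ
        lemma₃ = solve-∀
        vanish : ∀ i → i ℕ.< suc n → f i (combine a u (- f n u) u₀) ≡ 0ℤ
        vanish i i<1+n with ℕ.m<1+n⇒m<n∨m≡n i<1+n
        ... | inj₁ i<n  = trans (f-lin i a u _ u₀)
          (trans (cong₂ (λ s t → a * s + - f n u * t) (z i i<n) (z₀ i i<n)) (lemma₃ a (- f n u)))
        ... | inj₂ refl = trans (f-lin n a u _ u₀) (lemma₂ a (f n u))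
      IH = functional-dependence n f h′ f-lin h′-lin ker′
      k = proj₁ IH
      k≢0 = proj₁ (proj₂ IH)
      c = proj₁ (proj₂ (proj₂ IH))
      s : U → ℤ
      s u = Σ< n λ i → c i * f i u
      k*h : ∀ u → k * a * h u ≡ s u + k * b * f n u
      k*h u = trans (lemma k a (h u) b (f n u)) (cong (_+ k * b * f n u) (proj₂ (proj₂ (proj₂ IH)) u))
        where
        lemma : ∀ k a hu b fu → k * a * hu ≡ k * (a * hu + - b * fu) + k * b * fu
        lemma = solve-∀
      sum≡ : ∀ u → Σ< (suc n) (λ i → override n (k * b) c i * f i u) ≡ s u + k * b * f n u
      sum≡ u = cong₂ _+_ (Σ<-cong n λ i i<n → cong (_* f i u) (override-< (k * b) c i<n))
                         (cong (_* f n u) (override-≡ n (k * b) c))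

-- Generic sequences

  -- A requirement is a family of inequations w j · x ≠ c j, one of which has
  -- to hold; it is dense if it can still be met by a vector that is far out
  -- and orthogonal to finitely many of the commitments L i.
  Dense : (L : ℕ → V) (w : ℕ → V) → Set
  Dense L w = ∀ m n → Σ[ u ∈ Finite m ] (∀ i → i ℕ.< n → L i ∙ᶠ u ≡ 0ℤ) × ∃[ j ] w j ∙ᶠ u ≢ 0ℤ

  record GenericSequence (L : ℕ → V) (w : ℕ → ℕ → V) (c : ℕ → ℕ → ℤ) : Set where
    field
      x         : V
      x-null    : Null x
      x-commits : ∀ i → ∃[ z ] Pairs (L i) x z
      x-decides : ∀ k → Dense L (w k) → ∃[ j ] ¬ Pairs (w k j) x (c k j)

  module Generic (L : ℕ → V) (w : ℕ → ℕ → V) (c : ℕ → ℕ → ℤ) where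

    -- All later changes are divisible by the modulus.
    record Stage : Set where
      field
        len     : ℕ
        part    : Finite 0
        bound   : top part ℕ.≤ len
        modulus : ℤ
        nonzero : modulus ≢ 0ℤ

    open Stage

    value : V → Stage → ℤ
    value b st = dot b (vec (part st)) (len st)

    -- The approximation changes by `e` times `u`. Since `factor` enters the next modulus, later
    -- moves cannot undo the inequation secured by `decides`.
    record Move (k : ℕ) (st : Stage) : Set where
      field
        u        : Finite (len st)
        e        : ℤ
        divides-e : modulus st ∣ e
        orthogonal : ∀ i → i ℕ.< k → e * (L i ∙ᶠ u) ≡ 0ℤ
        factor   : ℤ
        factor≢0 : factor ≢ 0ℤ
        decides  : Dense L (w k) → ∃[ j ] ¬ (factor ∣ (value (w k j) st + e * (w k j ∙ᶠ u)) - c k j)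

    open Move

    next : ∀ k st → Move k st → Stage
    next k st mv = record
      -- The successor makes the lengths grow strictly, so that every coordinate becomes final.
      { len     = suc (len st ℕ.⊔ top (u mv))
      ; part    = record
        { vec   = λ i → vec (part st) i + e mv * vec (u mv) i
        ; top   = len st ℕ.⊔ top (u mv)
        ; below = λ _ ()
        ; above = λ i l → trans
            (cong₂ (λ a b → a + e mv * b)
              (above (part st) i (ℕ.≤-trans (bound st) (ℕ.m⊔n≤o⇒m≤o (len st) (top (u mv)) l)))
              (above (u mv) i (ℕ.m⊔n≤o⇒n≤o (len st) (top (u mv)) l)))
            (trans (+-identityˡ (e mv * 0ℤ)) (*-zeroʳ (e mv)))
        }
      ; bound   = ℕ.n≤1+n _
      -- Through the factors `suc k` every nonzero integer eventually divides the modulus, which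
      -- makes the limit a null sequence.
      ; modulus = modulus st * + suc k * factor mv
      ; nonzero = *-≢0 (*-≢0 (nonzero st) λ ()) (factor≢0 mv)
      }

    move : ∀ k st → Move k st
    move k st with em 0ℓ {Dense L (w k)}
    ... | no sparse = record
      { u          = zeroᶠ
      ; e          = 0ℤ
      ; divides-e  = ∣0
      ; orthogonal = λ _ _ → refl
      ; factor     = 1ℤ
      ; factor≢0   = λ ()
      ; decides    = λ dense → contradiction dense sparse
      }
    ... | yes dense = record
      { u          = v
      ; e          = proj₁ choice
      ; divides-e  = proj₁ (proj₂ choice)
      ; orthogonal = λ i i<k → trans (cong (proj₁ choice *_) (proj₁ (proj₂ (dense (len st) k)) i i<k))
          (*-zeroʳ (proj₁ choice))
      ; factor     = beyond gap
      ; factor≢0   = beyond≢0 {gap}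
      ; decides    = λ _ → j , λ p → proj₂ (proj₂ choice) (i-j≡0⇒i≡j _ _ (beyond∣⇒≡0 p))
      }
      where
      v = proj₁ (dense (len st) k)
      j = proj₁ (proj₂ (proj₂ (dense (len st) k)))
      vw≢0 = proj₂ (proj₂ (proj₂ (dense (len st) k)))
      y = value (w k j) st
      t = w k j ∙ᶠ v
      -- Since `t ≠ 0`, the changes `0` and `modulus st` lead to different values, so one of them
      -- avoids `c k j`.
      choice : ∃[ e ] modulus st ∣ e × y + e * t ≢ c k j
      choice with y ≟ c k j
      ... | no y≢c  = 0ℤ , ∣0 , λ eq → y≢c (trans (sym (+-identityʳ y)) eq)
      ... | yes y≡c = modulus st , ∣-refl , λ eq → *-≢0 (nonzero st) vw≢0
          (+-cancelˡ-≡0 y (modulus st * t) (trans eq (sym y≡c)))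
        where
        +-cancelˡ-≡0 : ∀ a b → a + b ≡ a → b ≡ 0ℤ
        +-cancelˡ-≡0 a b eq = trans (lemma a b) (i≡j⇒i-j≡0 eq)
          where
          lemma : ∀ a b → b ≡ (a + b) - a
          lemma = solve-∀
      gap = (y + proj₁ choice * t) - c k j

    stage : ℕ → Stage
    stage zero    = record
      { len = 0 ; part = zeroᶠ ; bound = ℕ.z≤n ; modulus = 1ℤ ; nonzero = λ () }
    stage (suc k) = next k (stage k) (move k (stage k))

    s : ℕ → V
    s k = vec (part (stage k))

    ℓ : ℕ → ℕ
    ℓ k = len (stage k)

    N : ℕ → ℤ
    N k = modulus (stage k)

    mv : ∀ k → Move k (stage k)
    mv k = move k (stage k)

    -- Stage `suc i` has length greater than `i`, so its entry at `i` is final.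
    x : V
    x i = s (suc i) i

    ℓ-step : ∀ k → ℓ k ℕ.< ℓ (suc k)
    ℓ-step k = ℕ.s≤s (ℕ.m≤m⊔n _ _)

    ℓ-≥ : ∀ k → k ℕ.≤ ℓ k
    ℓ-≥ zero    = ℕ.z≤n
    ℓ-≥ (suc k) = ℕ.≤-trans (ℕ.s≤s (ℓ-≥ k)) (ℓ-step k)

    N-step : ∀ k → N k ∣ N (suc k)
    N-step k = ∣m⇒∣m*n (factor (mv k)) (∣m⇒∣m*n (+ suc k) ∣-refl)

    N-suc : ∀ k → + suc k ∣ N (suc k)
    N-suc k = ∣m⇒∣m*n (factor (mv k)) (∣n⇒∣m*n (N k) ∣-refl)

    N-factor : ∀ k → factor (mv k) ∣ N (suc k)
    N-factor k = ∣n⇒∣m*n (N k * + suc k) ∣-refl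

    N-mono : ∀ {k n} → k ℕ.≤′ n → N k ∣ N n
    N-mono (ℕ.≤′-reflexive refl) = ∣-refl
    N-mono (ℕ.≤′-step {n} k≤n)   = ∣-trans (N-mono k≤n) (N-step n)

    ℓ-mono : ∀ {k n} → k ℕ.≤′ n → ℓ k ℕ.≤ ℓ n
    ℓ-mono (ℕ.≤′-reflexive refl) = ℕ.≤-refl
    ℓ-mono (ℕ.≤′-step {n} k≤n)   = ℕ.≤-trans (ℓ-mono k≤n) (ℕ.<⇒≤ (ℓ-step n))

    s-agree : ∀ {k n} → k ℕ.≤′ n → ∀ i → i ℕ.< ℓ k → s n i ≡ s k i
    s-agree (ℕ.≤′-reflexive refl) i i<ℓ = refl
    s-agree {k} (ℕ.≤′-step {n} k≤n) i i<ℓ = begin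
      s n i + e (mv n) * vec (u (mv n)) i
        ≡⟨ cong (λ t → s n i + e (mv n) * t) (below (u (mv n)) i (ℕ.<-≤-trans i<ℓ (ℓ-mono k≤n))) ⟩
      s n i + e (mv n) * 0ℤ ≡⟨ lemma (s n i) (e (mv n)) ⟩
      s n i                 ≡⟨ s-agree k≤n i i<ℓ ⟩
      s k i                 ∎
      where
      open ≡-Reasoning
      lemma : ∀ a b → a + b * 0ℤ ≡ a
      lemma = solve-∀

    x-agree : ∀ k i → i ℕ.< ℓ k → x i ≡ s k i
    x-agree k i i<ℓ with ℕ.≤-total k (suc i)
    ... | inj₁ k≤ = s-agree (ℕ.≤⇒≤′ k≤) i i<ℓ
    ... | inj₂ ≤k = sym (s-agree (ℕ.≤⇒≤′ ≤k) i (ℓ-≥ (suc i)))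

    s-divisible : ∀ {k n} → k ℕ.≤′ n → ∀ i → ℓ k ℕ.≤ i → N k ∣ s n i
    s-divisible {k} (ℕ.≤′-reflexive refl) i ℓ≤i =
      ∣-cong (sym (above (part (stage k)) i (ℕ.≤-trans (bound (stage k)) ℓ≤i))) ∣0
    s-divisible (ℕ.≤′-step {n} k≤n) i ℓ≤i = ∣m∣n⇒∣m+n (s-divisible k≤n i ℓ≤i)
      (∣m⇒∣m*n (vec (u (mv n)) i) (∣-trans (N-mono k≤n) (divides-e (mv n))))

    x-divisible : ∀ k i → ℓ k ℕ.≤ i → N k ∣ x i
    x-divisible k i ℓ≤i = s-divisible (ℕ.≤⇒≤′ (ℕ.m≤n⇒m≤1+n (ℕ.≤-trans (ℓ-≥ k) ℓ≤i))) i ℓ≤i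

    modulus-∣ : ∀ d → d ≢ 0ℤ → ∃[ k ] d ∣ N k
    modulus-∣ d d≢0 with ℤ.∣ d ∣ in eq
    ... | zero  = contradiction (∣i∣≡0⇒i≡0 eq) d≢0
    ... | suc k = suc k , ∣-trans (subst (λ n → d ∣ + n) eq m∣∣m∣) (N-suc k)

    x-null : Null x
    x-null d d≢0 = let (k , d∣N) = modulus-∣ d d≢0 in
      ℓ k , λ i ℓ≤i → ∣-trans d∣N (x-divisible k i ℓ≤i)

    x-approx : ∀ b k m → ℓ k ℕ.≤ m → N k ∣ dot b x m - value b (stage k)
    x-approx b k m ℓ≤m = ∣-cong (cong₂ _-_ (refl {x = dot b x m}) (dot-congʳ b (ℓ k) (x-agree k)))
      (dot-mod b x ℓ≤m λ i ℓ≤i _ → x-divisible k i ℓ≤i)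

    value-step : ∀ b k → value b (stage (suc k)) ≡ value b (stage k) + e (mv k) * (b ∙ᶠ u (mv k))
    value-step b k = begin
      dot b (s (suc k)) (ℓ (suc k))
        ≡⟨ dot-congʳ b (ℓ (suc k)) (λ i _ → lemma (s k i) (e (mv k)) (vec (u (mv k)) i)) ⟩
      dot b (λ i → 1ℤ * s k i + e (mv k) * vec (u (mv k)) i) (ℓ (suc k))
        ≡⟨ dot-linearʳ b 1ℤ (s k) (e (mv k)) (vec (u (mv k))) (ℓ (suc k)) ⟩
      1ℤ * dot b (s k) (ℓ (suc k)) + e (mv k) * dot b (vec (u (mv k))) (ℓ (suc k))
        ≡⟨ cong₂ (λ p q → 1ℤ * p + e (mv k) * q)
             (dot-stable b (s k) (ℕ.<⇒≤ (ℓ-step k))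
                 λ i ℓ≤i _ → above (part (stage k)) i (ℕ.≤-trans (bound (stage k)) ℓ≤i))
             (∙ᶠ-stable b (u (mv k)) (ℕ.≤-trans (ℕ.m≤n⊔m (ℓ k) _) (ℕ.n≤1+n _))) ⟩
      1ℤ * value b (stage k) + e (mv k) * (b ∙ᶠ u (mv k))
        ≡⟨ cong (_+ e (mv k) * (b ∙ᶠ u (mv k))) (*-identityˡ (value b (stage k))) ⟩
      value b (stage k) + e (mv k) * (b ∙ᶠ u (mv k)) ∎
      where
      open ≡-Reasoning
      lemma : ∀ a e u → a + e * u ≡ 1ℤ * a + e * u
      lemma = solve-∀

    value-committed : ∀ i {k n} → i ℕ.< k → k ℕ.≤′ n → value (L i) (stage n) ≡ value (L i) (stage k)
    value-committed i i<k (ℕ.≤′-reflexive refl) = refl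
    value-committed i {k} i<k (ℕ.≤′-step {n} k≤n) = begin
      value (L i) (stage (suc n))                              ≡⟨ value-step (L i) n ⟩
      value (L i) (stage n) + e (mv n) * (L i ∙ᶠ u (mv n))
        ≡⟨ cong₂ _+_ (value-committed i i<k k≤n) (orthogonal (mv n) i (ℕ.<-≤-trans i<k (ℕ.≤′⇒≤ k≤n))) ⟩
      value (L i) (stage k) + 0ℤ                               ≡⟨ +-identityʳ _ ⟩
      value (L i) (stage k)                                    ∎
      where open ≡-Reasoning

    -- From stage `suc i` on every move is orthogonal to `L i`, so the value of the approximations
    -- freezes there and becomes the sum of the series.
    x-commits : ∀ i → ∃[ z ] Pairs (L i) x z
    x-commits i = value (L i) (stage (suc i)) , pairs λ d d≢0 →
      let (k , d∣N) = modulus-∣ d d≢0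
          n         = suc i ℕ.⊔ k
      in ℓ n , λ m ℓ≤m → ∣-trans (∣-trans d∣N (N-mono (ℕ.≤⇒≤′ (ℕ.m≤n⊔m (suc i) k))))
        (∣-cong (cong₂ _-_ (refl {x = dot (L i) x m})
            (value-committed i ℕ.≤-refl (ℕ.≤⇒≤′ (ℕ.m≤m⊔n (suc i) k))))
          (x-approx (L i) n m ℓ≤m))

    -- Far enough out, the partial sums agree with the value at stage `suc k` modulo `N (suc k)`,
    -- hence modulo `factor`. Convergence to `c k j` would force exactly the divisibility that the
    -- move has excluded.
    x-decides : ∀ k → Dense L (w k) → ∃[ j ] ¬ Pairs (w k j) x (c k j)
    x-decides k dense = j , λ p →
      let (M , h) = Pairs.limit p (N (suc k)) (nonzero (stage (suc k)))
          m       = M ℕ.⊔ ℓ (suc k)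
      in ¬div (∣-trans (N-factor k) (∣-cong
        (trans (lemma (dot (w k j) x m) (c k j) (value (w k j) (stage (suc k))))
               (cong (_- c k j) (value-step (w k j) k)))
        (∣m∣n⇒∣m-n (h m (ℕ.m≤m⊔n M _)) (x-approx (w k j) (suc k) m (ℕ.m≤n⊔m M _)))))
      where
      j = proj₁ (decides (mv k) dense)
      ¬div = proj₂ (decides (mv k) dense)
      lemma : ∀ s c v → (s - c) - (s - v) ≡ v - c
      lemma = solve-∀

  abstract
    generic : ∀ L w c → GenericSequence L w c
    generic L w c = record { Generic L w c }

-- Enumerations

diagonal : ℕ × ℕ → ℕ × ℕ
diagonal (zero  , b) = suc b , zero
diagonal (suc a , b) = a , suc b

unpair : ℕ → ℕ × ℕ
unpair zero    = zero , zero
unpair (suc n) = diagonal (unpair n)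

abstract
  unpair-surjective : ∀ p → ∃[ n ] unpair n ≡ p
  unpair-surjective (a , b) = go (a ℕ.+ b) b a refl
    where
    go : ∀ s b a → a ℕ.+ b ≡ s → ∃[ n ] unpair n ≡ (a , b)
    go s       (suc b) a       eq = let (n , p) = go s b (suc a) (trans (sym (ℕ.+-suc a b)) eq) in
      suc n , cong diagonal p
    go zero    zero    zero    eq = zero , refl
    go (suc s) zero    (suc a) eq =
      let (n , p) = go s a zero (trans (sym (ℕ.+-identityʳ a)) (ℕ.suc-injective eq)) in
      suc n , cong diagonal p

toℤ : ℕ → ℤ
toℤ n = + proj₁ (unpair n) - + proj₂ (unpair n)

abstract
  toℤ-surjective : ∀ z → ∃[ n ] toℤ n ≡ z
  toℤ-surjective (+ k)    = let (n , eq) = unpair-surjective (k , 0) in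
    n , trans (cong (λ p → + proj₁ p - + proj₂ p) eq) (+-identityʳ (+ k))
  toℤ-surjective -[1+ k ] = let (n , eq) = unpair-surjective (0 , suc k) in
    n , cong (λ p → + proj₁ p - + proj₂ p) eq

-- One number codes an infinite sequence of which any finite initial part can be prescribed; the
-- remaining entries are arbitrary.
sequence : ℕ → ℕ → ℤ
sequence code zero    = toℤ (proj₁ (unpair code))
sequence code (suc i) = sequence (proj₂ (unpair code)) i

abstract
  sequence-surjective : ∀ n (c : ℕ → ℤ) → ∃[ code ] (∀ i → i ℕ.< n → sequence code i ≡ c i)
  sequence-surjective zero    c = 0 , λ _ ()
  sequence-surjective (suc n) c = prepend (toℤ-surjective (c 0)) (sequence-surjective n (c ∘ suc))
    where
    prepend : ∃[ h ] toℤ h ≡ c 0 → ∃[ t ] (∀ i → i ℕ.< n → sequence t i ≡ c (suc i)) →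
              ∃[ code ] (∀ i → i ℕ.< suc n → sequence code i ≡ c i)
    prepend (h , eq₀) (t , eq₁) = let (code , eq) = unpair-surjective (h , t) in code , λ
      { zero    _           → trans (cong (toℤ ∘ proj₁) eq) eq₀
      ; (suc i) (ℕ.s≤s i<n) → trans (cong (λ p → sequence (proj₂ p) i) eq) (eq₁ i i<n)
      }

-- One stage of the construction

Σ<-first : ∀ n (f : ℕ → ℤ) → Σ< (suc n) f ≡ f 0 + Σ< n (f ∘ suc)
Σ<-first zero    f = +-comm 0ℤ (f 0)
Σ<-first (suc n) f = trans (cong (_+ f (suc n)) (Σ<-first n f)) (+-assoc (f 0) _ _)

square-positive : ∀ {k} → k ≢ 0ℤ → ∃[ q ] k * k ≡ + suc q
square-positive {+ zero}   k≢0 = contradiction refl k≢0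
square-positive {+ suc k}  k≢0 = _ , refl
square-positive { -[1+ k ]} k≢0 = _ , refl

infixr 5 _∷ˢ_
_∷ˢ_ : ∀ {A : Set} → A → (ℕ → A) → ℕ → A
(x ∷ˢ xs) zero    = x
(x ∷ˢ xs) (suc i) = xs i

-- The j-th row of k M − l, where l is a scalar matrix.
row : (M : ℕ → V) (k l : ℤ) → ℕ → V
row M k l j i = k * M j i + - l * δ j i

-- The rows of k M − l from some point on are, up to finitely many columns,
-- rationally dependent on finitely many of the B t.
record NearlyScalar (M B : ℕ → V) : Set where
  field
    k        : ℤ
    k≢0      : k ≢ 0ℤ
    l        : ℤ
    J m n    : ℕ
    relation : ∀ j → ∃[ q ] q ≢ 0ℤ × Σ[ c ∈ (ℕ → ℤ) ]
      (∀ i → m ℕ.≤ i → q * row M k l (J ℕ.+ j) i ≡ Σ< n λ t → c t * B t i)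

-- `B` and `X` list what came before. In `separates`, `y` is the image of `x` under `M`, and the
-- clause is vacuous when no such integer sequence exists. Having `NearlyScalar` as its conclusion,
-- it requires no decision about `M` when the stage is built.
record Extension (M B X : ℕ → V) : Set where
  field
    x b       : V
    x-null    : Null x
    x-pairs   : ∀ i → ∃[ z ] Pairs (B i) x z
    b-pairs   : ∀ i → ∃[ z ] Pairs (X i) b z
    x-b-pair  : ∃[ z ] Pairs x b z
    b-fresh   : ∀ i → ¬ (∀ j → B i j ≡ b j)
    separates : ∀ y → (∀ j → Pairs (M j) x (y j)) → ∀ z → Pairs y b z → NearlyScalar M B

-- If `u` is orthogonal to all but the last of the vectors, take such a `v` beyond the support of
-- `u` and combine the two so that the last pairing cancels. The result keeps a nonzero entry of
-- `v`, whose coefficient is nonzero.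
orthogonal-vector : ∀ (L : ℕ → V) n m →
  Σ[ u ∈ Finite m ] (∀ i → i ℕ.< n → L i ∙ᶠ u ≡ 0ℤ) × ∃[ j ] vec u j ≢ 0ℤ
orthogonal-vector L zero    m = δᶠ (ℕ.≤-refl {m}) , (λ _ ()) , m , λ eq → 1≢0 (trans (sym (δ-diag m)) eq)
  where
  1≢0 : 1ℤ ≢ 0ℤ
  1≢0 ()
orthogonal-vector L (suc n) m with orthogonal-vector L n m
... | u , u⊥ , j , uⱼ≢0 with L n ∙ᶠ u ≟ 0ℤ
...   | yes Lu≡0 = u , (λ i i<1+n → case ℕ.m<1+n⇒m<n∨m≡n i<1+n of λ
          { (inj₁ i<n) → u⊥ i i<n ; (inj₂ refl) → Lu≡0 }) , j , uⱼ≢0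
...   | no  Lu≢0 with orthogonal-vector L n (m ℕ.⊔ top u)
...     | v , v⊥ , k , vₖ≢0 = comb a u b v′ , ⊥ , k , wₖ≢0
  where
  v′ : Finite m
  v′ = record
    { vec   = vec v
    ; top   = top v
    ; below = λ i i<m → below v i (ℕ.<-≤-trans i<m (ℕ.m≤m⊔n m (top u)))
    ; above = above v
    }
  a = L n ∙ᶠ v
  b = - (L n ∙ᶠ u)
  ⊥ : ∀ i → i ℕ.< suc n → L i ∙ᶠ comb a u b v′ ≡ 0ℤ
  ⊥ i i<1+n with ℕ.m<1+n⇒m<n∨m≡n i<1+n
  ... | inj₁ i<n  = trans (∙ᶠ-linear (L i) a u b v′)
    (trans (cong₂ (λ s t → a * s + b * t) (u⊥ i i<n) (v⊥ i i<n)) (lemma a b))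
    where
    lemma : ∀ a b → a * 0ℤ + b * 0ℤ ≡ 0ℤ
    lemma = solve-∀
  ... | inj₂ refl = trans (∙ᶠ-linear (L n) a u b v′) (lemma a (L n ∙ᶠ u))
    where
    lemma : ∀ a b → a * b + - b * a ≡ 0ℤ
    lemma = solve-∀
  top≤k : m ℕ.⊔ top u ℕ.≤ k
  top≤k = ℕ.≮⇒≥ λ k<top → vₖ≢0 (below v k k<top)
  wₖ≢0 : a * vec u k + b * vec v k ≢ 0ℤ
  wₖ≢0 eq = *-≢0 (λ b≡0 → Lu≢0 (neg-injective b≡0)) vₖ≢0
    (trans (lemma a (b * vec v k))
        (trans (cong (λ t → a * t + b * vec v k) (sym (above u k (ℕ.m⊔n≤o⇒n≤o m (top u) top≤k)))) eq))
    where
    lemma : ∀ a t → t ≡ a * 0ℤ + t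
    lemma = solve-∀

module _ (em : ∀ ℓ → ExcludedMiddle ℓ) where
  open Classical em

  -- Where density fails, each `w j` vanishes on the far-out vectors orthogonal to the first `n`
  -- commitments, hence depends on these as a functional. Evaluation at unit vectors gives the
  -- relation of entries.
  sparse⇒dependent : ∀ {L w} → ¬ Dense L w → ∃[ m ] ∃[ n ] (∀ j → ∃[ q ] q ≢ 0ℤ × Σ[ c ∈ (ℕ → ℤ) ]
    (∀ i → m ℕ.≤ i → q * w j i ≡ Σ< n λ t → c t * L t i))
  sparse⇒dependent {L} {w} sparse = m , n , λ j →
    let (q , q≢0 , c , eq) = functional-dependence (comb {m}) n (λ t u → L t ∙ᶠ u) (w j ∙ᶠ_)
          (λ t → ∙ᶠ-linear (L t)) (∙ᶠ-linear (w j))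
          λ u u⊥ → dne λ wu≢0 → none (u , u⊥ , j , wu≢0)
    in q , q≢0 , c , λ i m≤i → trans (cong (q *_) (sym (∙ᶠ-δ (w j) m≤i)))
         (trans (eq (δᶠ m≤i)) (Σ<-cong n λ t _ → cong (c t *_) (∙ᶠ-δ (L t) m≤i)))
    where
    s₁ = ¬∀⇒∃¬ sparse
    m = proj₁ s₁
    s₂ = ¬∀⇒∃¬ (proj₂ s₁)
    n = proj₁ s₂
    none = proj₂ s₂

  module _ (M B X : ℕ → V) where

    private
      -- Requirement `r` codes one possible relation `k y = l x + Σ cₜ Xₜ`, with `y` the image of
      -- `x`, valid from coordinate `Jᵣ r` on. The generic `x` has to violate it at some coordinate;
      -- ignoring the earlier ones accounts for `S`.
      kᵣ lᵣ : ℕ → ℤ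
      kᵣ r = + suc ℤ.∣ sequence r 0 ∣
      lᵣ r = sequence r 1
      nᵣ Jᵣ : ℕ → ℕ
      nᵣ r = ℤ.∣ sequence r 2 ∣
      Jᵣ r = ℤ.∣ sequence r 3 ∣
      cᵣ : ℕ → ℕ → ℤ
      cᵣ r t = sequence r (4 ℕ.+ t)

      combination : (n : ℕ) (c : ℕ → ℤ) → V
      combination n c i = Σ< n λ t → c t * X t i

      module GX = GenericSequence (generic B
        (λ r j → row M (kᵣ r) (lᵣ r) (Jᵣ r ℕ.+ j))
        (λ r j → combination (nᵣ r) (cᵣ r) (Jᵣ r ℕ.+ j)))

      x : V
      x = GX.x

      decide-y : Dec (Σ[ y ∈ V ] (∀ j → Pairs (M j) x (y j)))
      decide-y = em 0ℓ

      -- The image of x under M if it is an integer sequence, and a junk value otherwise.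
      image : Dec (Σ[ y ∈ V ] (∀ j → Pairs (M j) x (y j))) → V
      image (yes (y , _)) = y
      image (no _)        = λ _ → 0ℤ

      y₀ : V
      y₀ = image decide-y

      y₀-unique : ∀ y → (∀ j → Pairs (M j) x (y j)) → ∀ j → y j ≡ y₀ j
      y₀-unique y p j with decide-y
      ... | yes (y′ , p′) = Pairs-unique (p j) (p′ j)
      ... | no  none      = contradiction (y , p) none

      -- Requirement `(0 , z)` forbids one integer as the pairing of `b` with `y₀`, and together
      -- these forbid all integers. Requirement `(suc i , _)` makes `b` differ from `B i` at some
      -- coordinate.
      wᵇ : ℕ × ℕ → ℕ → V
      wᵇ (zero  , _) j = y₀
      wᵇ (suc i , _) j = δ j

      cᵇ : ℕ × ℕ → ℕ → ℤ
      cᵇ (zero  , z) j = toℤ z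
      cᵇ (suc i , _) j = B i j

      -- With `x` among the commitments, `b` becomes integral on the new vector too.
      module GB = GenericSequence (generic (x ∷ˢ X) (wᵇ ∘ unpair) (cᵇ ∘ unpair))

      fresh : ∀ i → ¬ (∀ j → B i j ≡ GB.x j)
      fresh i B≗b = proj₂ (decided) (subst (λ p → Pairs (wᵇ p j) GB.x (cᵇ p j)) (sym eq)
          (subst (Pairs (δ j) GB.x) (sym (B≗b j)) (Pairs-sym (Pairs-δʳ GB.x j))))
        where
        r = proj₁ (unpair-surjective (suc i , 0))
        eq = proj₂ (unpair-surjective (suc i , 0))
        dense : Dense (x ∷ˢ X) (wᵇ (unpair r))
        dense rewrite eq = λ m n → let (u , u⊥ , j , uⱼ≢0) = orthogonal-vector (x ∷ˢ X) n m in
          u , u⊥ , j , λ eq → uⱼ≢0 (trans (sym (trans (dot-comm (δ j) (vec u) (top u))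
            (dot-δ (vec u) (ℕ.≰⇒> λ top≤j → uⱼ≢0 (above u j top≤j))))) eq)
        decided = GB.x-decides r dense
        j = proj₁ decided

      dense-x : ¬ NearlyScalar M B → ∀ r → Dense B (λ j → row M (kᵣ r) (lᵣ r) (Jᵣ r ℕ.+ j))
      dense-x ¬ns r = dne λ sparse → let (m , n , rel) = sparse⇒dependent sparse in ¬ns record
        { k = kᵣ r ; k≢0 = λ () ; l = lᵣ r ; J = Jᵣ r ; m = m ; n = n ; relation = rel }

      -- y is not in the pure subgroup generated by S, x and the X t.
      independent : ¬ NearlyScalar M B → (y : V) → (∀ j → Pairs (M j) x (y j)) →
        (q : ℤ) → q ≢ 0ℤ → (l : ℤ) (n : ℕ) (c : ℕ → ℤ) (m : ℕ) →
            ¬ (∀ i → m ℕ.≤ i → q * y i ≡ l * x i + combination n c i)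
      independent ¬ns y p q q≢0 l n c m rel = proj₂ decided (subst (Pairs (row M (kᵣ r) (lᵣ r) J′) x) val
          (Pairs-linearˡ (kᵣ r) (- lᵣ r) (p J′) (Pairs-sym (Pairs-δʳ x J′))))
        where
        sq = square-positive q≢0
        target : ℕ → ℤ
        -- The given relation multiplied by `q`: its leading coefficient becomes the positive number
        -- `q * q`, which is a successor as `kᵣ` demands.
        target = + proj₁ sq ∷ˢ q * l ∷ˢ + n ∷ˢ + m ∷ˢ λ t → q * c t
        code = sequence-surjective (4 ℕ.+ n) target
        r = proj₁ code
        agrees = proj₂ code
        decided = GX.x-decides r (dense-x ¬ns r)
        j = proj₁ decided
        J′ = Jᵣ r ℕ.+ j
        n≡ : nᵣ r ≡ n
        n≡ = cong ℤ.∣_∣ (agrees 2 (ℕ.s≤s (ℕ.s≤s (ℕ.s≤s ℕ.z≤n))))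
        k≡ : kᵣ r ≡ q * q
        k≡ = trans (cong (λ z → + suc ℤ.∣ z ∣) (agrees 0 (ℕ.s≤s ℕ.z≤n))) (sym (proj₂ sq))
        l≡ : lᵣ r ≡ q * l
        l≡ = agrees 1 (ℕ.s≤s (ℕ.s≤s ℕ.z≤n))
        J≡ : Jᵣ r ≡ m
        J≡ = cong ℤ.∣_∣ (agrees 3 (ℕ.s≤s (ℕ.s≤s (ℕ.s≤s (ℕ.s≤s ℕ.z≤n)))))
        m≤J′ : m ℕ.≤ J′
        m≤J′ = subst (ℕ._≤ J′) J≡ (ℕ.m≤m+n (Jᵣ r) j)
        val : kᵣ r * y J′ + - lᵣ r * x J′ ≡ combination (nᵣ r) (cᵣ r) J′
        val = begin
          kᵣ r * y J′ + - lᵣ r * x J′       ≡⟨ cong₂ (λ k l → k * y J′ + - l * x J′) k≡ l≡ ⟩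
          q * q * y J′ + - (q * l) * x J′   ≡⟨ lemma₁ q (y J′) l (x J′) ⟩
          q * (q * y J′ - l * x J′)         ≡⟨ cong (λ t → q * (t - l * x J′)) (rel J′ m≤J′) ⟩
          q * (l * x J′ + combination n c J′ - l * x J′) ≡⟨ lemma₂ q (l * x J′) (combination n c J′) ⟩
          combination n c J′ * q            ≡⟨ Σ<-*ʳ n q (λ t → c t * X t J′) ⟨
          Σ< n (λ t → c t * X t J′ * q)     ≡⟨ Σ<-cong n (λ t t<n → trans (lemma₃ (c t) (X t J′) q)
                                                 (cong (_* X t J′)
                                                     (sym (agrees (4 ℕ.+ t) (ℕ.+-monoʳ-< 4 t<n))))) ⟩
          combination n (cᵣ r) J′           ≡⟨ cong (λ n → combination n (cᵣ r) J′) n≡ ⟨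
          combination (nᵣ r) (cᵣ r) J′      ∎
          where
          open ≡-Reasoning
          lemma₁ : ∀ q y l x → q * q * y + - (q * l) * x ≡ q * (q * y - l * x)
          lemma₁ = solve-∀
          lemma₂ : ∀ q a b → q * (a + b - a) ≡ b * q
          lemma₂ = solve-∀
          lemma₃ : ∀ c x q → c * x * q ≡ q * c * x
          lemma₃ = solve-∀

      -- Sparsity would make `y₀` rationally dependent on `x` and finitely many `X t` from some
      -- coordinate on, which `independent` excludes. The family is constant, so its member at index
      -- 0 tells everything.
      dense-y : ¬ NearlyScalar M B → (∀ j → Pairs (M j) x (y₀ j)) → Dense (x ∷ˢ X) (λ _ → y₀)
      dense-y ¬ns p = dne λ sparse → go (sparse⇒dependent sparse)
        where
        go : ¬ (∃[ m ] ∃[ n ] (∀ (j : ℕ) → ∃[ q ] q ≢ 0ℤ × Σ[ c ∈ (ℕ → ℤ) ]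
          (∀ i → m ℕ.≤ i → q * y₀ i ≡ Σ< n λ t → c t * (x ∷ˢ X) t i)))
        go (m , n , dep) with dep 0
        go (m , zero , _) | q , q≢0 , c , rel = independent ¬ns y₀ p q q≢0 0ℤ 0 c m
          λ i m≤i → trans (rel i m≤i) (zeros (x i))
          where
          zeros : ∀ a → 0ℤ ≡ 0ℤ * a + 0ℤ
          zeros = solve-∀
        go (m , suc n , _) | q , q≢0 , c , rel = independent ¬ns y₀ p q q≢0 (c 0) n (c ∘ suc) m
          λ i m≤i → trans (rel i m≤i) (Σ<-first n λ t → c t * (x ∷ˢ X) t i)

      -- The integer `z` is one of the forbidden values, and the requirement forbidding it is dense
      -- unless `M` is nearly scalar.
      separate : ∀ y → (∀ j → Pairs (M j) x (y j)) → ∀ z → Pairs y GB.x z → NearlyScalar M B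
      separate y p z yb = dne λ ¬ns → refute ¬ns
        where
        z′ = toℤ-surjective z
        rr = unpair-surjective (0 , proj₁ z′)
        r = proj₁ rr
        p₀ : ∀ j → Pairs (M j) x (y₀ j)
        p₀ j = subst (Pairs (M j) x) (y₀-unique y p j) (p j)
        refute : ¬ ¬ NearlyScalar M B
        refute ¬ns = proj₂ decided (subst (λ s → Pairs (wᵇ s j) GB.x (cᵇ s j)) (sym (proj₂ rr))
          (subst (Pairs y₀ GB.x) (sym (proj₂ z′)) (Pairs-congˡ (y₀-unique y p) yb)))
          where
          decided = GB.x-decides r
            (subst (λ s → Dense (x ∷ˢ X) (wᵇ s)) (sym (proj₂ rr)) (dense-y ¬ns p₀))
          j = proj₁ decided

    extension : Extension M B X
    extension = record
      { x         = x
      ; b         = GB.x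
      ; x-null    = GX.x-null
      ; x-pairs   = GX.x-commits
      ; b-pairs   = λ i → GB.x-commits (suc i)
      ; x-b-pair  = GB.x-commits 0
      ; b-fresh   = fresh
      ; separates = separate
      }

-- The transfinite construction

module _ (ac : ∀ ℓ → AxiomOfChoice ℓ) (A : Setoid 0ℓ 0ℓ) where
  private module A = Setoid A

  abstract
    -- Choice for the relation `≈` itself: since the choice function respects equality, it picks one
    -- representative from each class.
    normalForm : Σ[ nf ∈ (A.Carrier → A.Carrier) ]
      (∀ x → nf x A.≈ x) × (∀ {x y} → x A.≈ y → nf x ≡ nf y)
    normalForm =
      let (f , p) = ac 0ℓ A (setoid A.Carrier) (λ x y → y A.≈ x)
                       (λ x≈x′ y≈x → A.trans y≈x x≈x′) (λ { refl y≈x → y≈x }) (λ x → x , A.refl)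
      in Func.to f , p , Func.cong f

Matrix : Set
Matrix = ℕ → V

matrices : Setoid 0ℓ 0ℓ
matrices = record
  { Carrier = Matrix × Matrix × Matrix
  ; _≈_     = λ (M , B , X) (M′ , B′ , X′) →
      (∀ j i → M j i ≡ M′ j i) × (∀ j i → B j i ≡ B′ j i) × (∀ j i → X j i ≡ X′ j i)
  ; isEquivalence = record
    { refl  = (λ _ _ → refl) , (λ _ _ → refl) , (λ _ _ → refl)
    ; sym   = λ (p , q , r) → (λ j i → sym (p j i)) , (λ j i → sym (q j i)) , (λ j i → sym (r j i))
    ; trans = λ (p , q , r) (p′ , q′ , r′) →
        (λ j i → trans (p j i) (p′ j i)) , (λ j i → trans (q j i) (q′ j i)) ,
            (λ j i → trans (r j i) (r′ j i))
    }
  }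

NearlyScalar-cong : ∀ {M M′ B B′} → (∀ j i → M j i ≡ M′ j i) → (∀ j i → B j i ≡ B′ j i) →
                    NearlyScalar M B → NearlyScalar M′ B′
NearlyScalar-cong M≗ B≗ ns = record
  { k = k ; k≢0 = k≢0 ; l = l ; J = J ; m = m ; n = n
  ; relation = λ j → let (q , q≢0 , c , rel) = relation j in q , q≢0 , c , λ i m≤i →
      trans (cong (λ t → q * (k * t + - l * δ (J ℕ.+ j) i)) (sym (M≗ (J ℕ.+ j) i)))
        (trans (rel i m≤i) (Σ<-cong n λ t _ → cong (c t *_) (B≗ t i)))
  }
  where open NearlyScalar ns

-- By `pairing` every `X w` will lie in the group. In `kills`, `C` lists the functionals known at
-- the stage of `M`, padded with zeros where the enumeration has gaps.
record Tower (W : StrictTotalOrder 0ℓ 0ℓ 0ℓ) : Set where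
  open StrictTotalOrder W using (Carrier; _≈_; _<_)
  field
    X B    : Carrier → V
    X-null : ∀ w → Null (X w)
    pairing : ∀ v w → ∃[ z ] Pairs (B v) (X w) z
    B-cong : ∀ {v w} → v ≈ w → B v ≡ B w
    fresh  : ∀ {v w} → v < w → ¬ (∀ j → B v j ≡ B w j)
    kills  : ∀ (M : Matrix) → ∃[ w ] (∀ y → (∀ j → Pairs (M j) (X w) (y j)) → ∀ z → Pairs y (B w) z →
               Σ[ C ∈ Matrix ] (∀ n → (∃[ v ] C n ≡ B v) ⊎ (∀ i → C n i ≡ 0ℤ)) × NearlyScalar M C)

module _ (em : ∀ ℓ → ExcludedMiddle ℓ) (ac : ∀ ℓ → AxiomOfChoice ℓ)
         (W : StrictTotalOrder 0ℓ 0ℓ 0ℓ) (ω₁ : HasOrderTypeω₁ W)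
         (bijection : Bijection (StrictTotalOrder.Eq.setoid W) (ℕ →-setoid Bool)) where

  private
    module W = StrictTotalOrder W
    open W using (_<_; _≈_) renaming (Carrier to I)
    open HasOrderTypeω₁ ω₁
    module Code = Bijection bijection

    nf : I → I
    nf = proj₁ (normalForm ac W.Eq.setoid)

    nf-≈ : ∀ w → nf w ≈ w
    nf-≈ = proj₁ (proj₂ (normalForm ac W.Eq.setoid))

    nf-cong : ∀ {v w} → v ≈ w → nf v ≡ nf w
    nf-cong = proj₂ (proj₂ (normalForm ac W.Eq.setoid))

    Graph : I → ℕ → ℕ → ℕ → Set
    Graph w j i p = proj₁ (unpair p) ≡ j × proj₁ (unpair (proj₂ (unpair p))) ≡ i × Code.to w p ≡ true

    entryAt : ℕ → ℤ
    entryAt p = toℤ (proj₂ (unpair (proj₂ (unpair p))))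

    -- The matrix whose graph is coded by w through the surjection ℕ → ℕ × ℕ × ℤ;
    -- an entry without a code is 0.
    matrix : I → Matrix
    matrix w j i with em 0ℓ {∃[ p ] Graph w j i p}
    ... | yes (p , _) = entryAt p
    ... | no  _       = 0ℤ

    code : Matrix → ℕ → Bool
    code M p = does (M (proj₁ (unpair p)) (proj₁ (unpair (proj₂ (unpair p)))) ≟ entryAt p)

    matrix-surjective : ∀ M → ∃[ w ] (∀ j i → matrix (nf w) j i ≡ M j i)
    matrix-surjective M = w , decoded
      where
      w = proj₁ (Code.surjective (code M))
      coded : ∀ p → Code.to (nf w) p ≡ code M p
      coded = proj₂ (Code.surjective (code M)) (nf-≈ w)
      decoded : ∀ j i → matrix (nf w) j i ≡ M j i
      decoded j i with em 0ℓ {∃[ p ] Graph (nf w) j i p}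
      ... | yes (p , refl , refl , is-true) = entry-correct p (trans (sym (coded p)) is-true)
        where
        entry-correct : ∀ p → code M p ≡ true →
          entryAt p ≡ M (proj₁ (unpair p)) (proj₁ (unpair (proj₂ (unpair p))))
        entry-correct p eq with M (proj₁ (unpair p)) (proj₁ (unpair (proj₂ (unpair p)))) ≟ entryAt p
        ... | yes eq′ = sym eq′
        entry-correct p () | no _
      ... | no none = contradiction (p , graph) none
        where
        z = toℤ-surjective (M j i)
        q = unpair-surjective (i , proj₁ z)
        r = unpair-surjective (j , proj₁ q)
        p = proj₁ r
        eq₁ : unpair p ≡ (j , proj₁ q)
        eq₁ = proj₂ r
        eq₂ : unpair (proj₂ (unpair p)) ≡ (i , proj₁ z)
        eq₂ = trans (cong (unpair ∘ proj₂) eq₁) (proj₂ q)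
        graph : Graph (nf w) j i p
        graph = cong proj₁ eq₁ , cong proj₁ eq₂ , trans (coded p) (dec-true (_ ≟ _)
          (trans (cong₂ M (cong proj₁ eq₁) (cong proj₁ eq₂))
                 (sym (trans (cong (toℤ ∘ proj₂) eq₂) (proj₂ z)))))

    Below : I → Set
    Below w = ∃[ v ] v < w

    -- Classical inversion of the injection into ℕ, with `nothing` off its range. Listing `nf v`
    -- makes the outcome independent of which preimage is found.
    enumerate : ∀ w → ℕ → Maybe (Below w)
    enumerate w n with em 0ℓ {∃[ v ] Injection.to (initialSegmentsCountable w) v ≡ n}
    ... | yes ((v , v<w) , _) = just (nf v , W.<-respˡ-≈ (W.Eq.sym (nf-≈ v)) v<w)
    ... | no  _               = nothing

    enumerate-covers : ∀ {v w} → v < w → ∃[ n ] ∃[ p ] enumerate w n ≡ just (nf v , p)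
    enumerate-covers {v} {w} v<w = n , found
      where
      open Injection (initialSegmentsCountable w)
      n = to (v , v<w)
      found : ∃[ p ] enumerate w n ≡ just (nf v , p)
      found with em 0ℓ {∃[ u ] to u ≡ n}
      ... | no  none            = contradiction ((v , v<w) , refl) none
      ... | yes ((u , u<w) , eq) = subst (λ t → (p : t < w) → ∃[ q ] just (t , p) ≡ just (nf v , q))
              (sym (nf-cong {u} {v} (injective {u , u<w} {v , v<w} eq))) (λ p → p , refl) _

    enumerate-normal : ∀ w n {v p} → enumerate w n ≡ just (v , p) → ∃[ u ] v ≡ nf u
    enumerate-normal w n eq with em 0ℓ {∃[ v ] Injection.to (initialSegmentsCountable w) v ≡ n}
    enumerate-normal w n refl | yes ((u , _) , _) = u , refl

    zeroV : V
    zeroV _ = 0ℤ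

    entry : ∀ {w} → Maybe (Below w) → (∀ v → v < w → V × V) → V × V
    entry (just (v , v<w)) f = f v v<w
    entry nothing          f = zeroV , zeroV

    entry-cong : ∀ {w} (e : Maybe (Below w)) {f g : ∀ v → v < w → V × V} →
                 (∀ v p → f v p ≡ g v p) → entry e f ≡ entry e g
    entry-cong (just (v , v<w)) f≗g = f≗g v v<w
    entry-cong nothing          f≗g = refl

    canonical : Matrix × Matrix × Matrix → Matrix × Matrix × Matrix
    canonical = proj₁ (normalForm ac matrices)

    input : I → (ℕ → V × V) → Matrix × Matrix × Matrix
    input w h = matrix w , proj₂ ∘ h , proj₁ ∘ h

    -- Normalising the matrices by choice makes the stage depend on h only up to
    -- pointwise equality, for want of function extensionality.
    stage : ∀ w (h : ℕ → V × V) →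
      let (M , B , X) = canonical (input w h) in Extension M B X
    stage w h = extension em _ _ _

    step : I → (ℕ → V × V) → V × V
    step w h = Extension.x (stage w h) , Extension.b (stage w h)

    step-cong : ∀ w {h h′} → (∀ n → h n ≡ h′ n) → step w h ≡ step w h′
    step-cong w {h} {h′} h≗h′ = cong
      (λ t → Extension.x (extension em (proj₁ t) (proj₁ (proj₂ t)) (proj₂ (proj₂ t))) ,
             Extension.b (extension em (proj₁ t) (proj₁ (proj₂ t)) (proj₂ (proj₂ t))))
      (proj₂ (proj₂ (normalForm ac matrices)) {input w h} {input w h′}
        ((λ _ _ → refl) , (λ j i → cong (λ p → proj₂ p i) (h≗h′ j)) ,
            (λ j i → cong (λ p → proj₁ p i) (h≗h′ j))))

    build : ∀ w → Acc _<_ w → V × V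
    build w (acc rs) = step w λ n → entry (enumerate w n) λ v v<w → build v (rs v<w)

    -- The histories arising from two accessibility proofs agree only pointwise; `step-cong` turns
    -- this into equality of the results.
    build-irrelevant : ∀ w (a a′ : Acc _<_ w) → build w a ≡ build w a′
    build-irrelevant w (acc rs) (acc rs′) = step-cong w λ n → entry-cong (enumerate w n) λ v v<w →
      build-irrelevant v (rs v<w) (rs′ v<w)

    val : I → V × V
    val w = build w (wellFounded w)

    history : I → ℕ → V × V
    history w n = entry (enumerate w n) λ v _ → val v

    val-step : ∀ w → val w ≡ step w (history w)
    val-step w = unfold (wellFounded w)
      where
      unfold : ∀ a → build w a ≡ step w (history w)
      unfold (acc rs) = step-cong w λ n → entry-cong (enumerate w n) λ v v<w →
        build-irrelevant v (rs v<w) (wellFounded v)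

    history-covers : ∀ {v w} → v < w → ∃[ n ] history w n ≡ val (nf v)
    history-covers {v} {w} v<w = let (n , p , eq) = enumerate-covers v<w in
      n , cong (λ e → entry e λ v _ → val v) eq

    history-values : ∀ w n → (∃[ v ] history w n ≡ val (nf v)) ⊎ history w n ≡ (zeroV , zeroV)
    history-values w n with enumerate w n in eq
    ... | nothing      = inj₂ refl
    ... | just (v , p) = let (u , v≡nfu) = enumerate-normal w n eq in inj₁ (u , cong val v≡nfu)

    module At (w : I) where
      open Extension (stage w (history w)) public

      canonical-≈ : Setoid._≈_ matrices (canonical (input w (history w))) (input w (history w))
      canonical-≈ = proj₁ (proj₂ (normalForm ac matrices)) (input w (history w))

      x≡ : x ≡ proj₁ (val w)
      x≡ = sym (cong proj₁ (val-step w))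

      b≡ : b ≡ proj₂ (val w)
      b≡ = sym (cong proj₂ (val-step w))

      Bs-≗ : ∀ n i → proj₁ (proj₂ (canonical (input w (history w)))) n i ≡ proj₂ (history w n) i
      Bs-≗ = proj₁ (proj₂ canonical-≈)

      Xs-≗ : ∀ n i → proj₂ (proj₂ (canonical (input w (history w)))) n i ≡ proj₁ (history w n) i
      Xs-≗ = proj₂ (proj₂ canonical-≈)

    -- Evaluation at `nf w` assigns identical vectors to equivalent indices.
    X B : I → V
    X w = proj₁ (val (nf w))
    B w = proj₂ (val (nf w))

    below-nf : ∀ {v w} → v < w → v < nf w
    below-nf {v} {w} = W.<-respʳ-≈ (W.Eq.sym (nf-≈ w))

    x-pairs : ∀ {v w} → v < w → ∃[ z ] Pairs (B v) (X w) z
    x-pairs {v} {w} v<w =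
      let (n , eq) = history-covers (below-nf v<w) ; (z , p) = E.x-pairs n in
      z , subst (λ x → Pairs (B v) x z) E.x≡
            (Pairs-congˡ (λ i → trans (E.Bs-≗ n i) (cong (λ t → proj₂ t i) eq)) p)
      where module E = At (nf w)

    b-pairs : ∀ {v w} → v < w → ∃[ z ] Pairs (B w) (X v) z
    b-pairs {v} {w} v<w =
      let (n , eq) = history-covers (below-nf v<w) ; (z , p) = E.b-pairs n in
      z , subst (λ b → Pairs b (X v) z) E.b≡
            (Pairs-sym (Pairs-congˡ (λ i → trans (E.Xs-≗ n i) (cong (λ t → proj₁ t i) eq)) p))
      where module E = At (nf w)

    -- The later of the two stages is responsible: its `x` is committed to the earlier `b`, its `b`
    -- to the earlier `x`, and within one stage `b` is committed to `x`.
    pair : ∀ v w → ∃[ z ] Pairs (B v) (X w) z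
    pair v w with W.compare v w
    ... | tri< v<w _ _ = x-pairs v<w
    ... | tri> _ _ w<v = b-pairs w<v
    ... | tri≈ _ v≈w _ = subst (λ u → ∃[ z ] Pairs (proj₂ (val u)) (X w) z) (sym (nf-cong v≈w))
      (subst₂ (λ b x → ∃[ z ] Pairs b x z) E.b≡ E.x≡
        (proj₁ E.x-b-pair , Pairs-sym (proj₂ E.x-b-pair)))
      where module E = At (nf w)

    fresh : ∀ {v w} → v < w → ¬ (∀ j → B v j ≡ B w j)
    fresh {v} {w} v<w B≗ = let (n , eq) = history-covers (below-nf v<w) in
      E.b-fresh n λ j → trans (E.Bs-≗ n j)
        (trans (cong (λ t → proj₂ t j) eq) (trans (B≗ j) (cong (λ b → b j) (sym E.b≡))))
      where module E = At (nf w)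

    kills : ∀ (M : Matrix) → ∃[ w ] (∀ y → (∀ j → Pairs (M j) (X w) (y j)) → ∀ z → Pairs y (B w) z →
              Σ[ C ∈ Matrix ] (∀ n → (∃[ v ] C n ≡ B v) ⊎ (∀ i → C n i ≡ 0ℤ)) × NearlyScalar M C)
    kills M = w , λ y p z q →
        proj₂ ∘ history (nf w) , values ,
        NearlyScalar-cong M≗ E.Bs-≗ (E.separates y
          (λ j → subst (λ x → Pairs (M′ j) x (y j)) (sym E.x≡) (Pairs-congˡ (λ i → sym (M≗ j i)) (p j)))
          z (subst (λ b → Pairs y b z) (sym E.b≡) q))
      where
      w : I
      w = proj₁ (matrix-surjective M)
      module E = At (nf w)
      M′ : Matrix
      M′ = proj₁ (canonical (input (nf w) (history (nf w))))
      M≗ : ∀ j i → M′ j i ≡ M j i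
      M≗ j i = trans (proj₁ E.canonical-≈ j i) (proj₂ (matrix-surjective M) j i)
      values : ∀ n → (∃[ v ] proj₂ (history (nf w) n) ≡ B v) ⊎ (∀ i → proj₂ (history (nf w) n) i ≡ 0ℤ)
      values n = [ (λ (v , eq) → inj₁ (v , cong proj₂ eq))
                 , (λ eq → inj₂ λ i → cong (λ t → proj₂ t i) eq) ]′ (history-values (nf w) n)

  abstract
    tower : Tower W
    tower = record
      { X       = X
      ; B       = B
      ; X-null  = λ w → subst Null (At.x≡ (nf w)) (At.x-null (nf w))
      ; pairing = pair
      ; B-cong  = λ v≈w → cong (proj₂ ∘ val) (nf-cong v≈w)
      ; fresh   = fresh
      ; kills   = kills
      }

-- Additive functionals

-- Equations in subgroups of `P` are checked coordinatewise; coordinates, pairings and their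
-- combinations are all of this form, and compatibility with multiples and sums then follows once
-- for all.
record Additive (A : Ab) (f : ∣ A ∣ → ℤ) : Set where
  open AbelianGroup A using (_≈_; _∙_)
  field
    f-cong : ∀ {x y} → x ≈ y → f x ≡ f y
    f-∙    : ∀ x y → f (x ∙ y) ≡ f x + f y

module AdditiveProperties {A : Ab} {f : ∣ A ∣ → ℤ} (additive : Additive A f) where
  open AbelianGroup A using (_≈_; _∙_; ε; _⁻¹; identityˡ; inverseʳ; rawMonoid)
  open Additive additive

  f-ε : f ε ≡ 0ℤ
  f-ε = begin
    f ε               ≡⟨ lemma (f ε) ⟨
    (f ε + f ε) - f ε ≡⟨ cong (_- f ε) (f-∙ ε ε) ⟨
    f (ε ∙ ε) - f ε   ≡⟨ cong (_- f ε) (f-cong (identityˡ ε)) ⟩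
    f ε - f ε         ≡⟨ +-inverseʳ (f ε) ⟩
    0ℤ                ∎
    where
    open ≡-Reasoning
    lemma : ∀ a → (a + a) - a ≡ a
    lemma = solve-∀

  f-⁻¹ : ∀ x → f (x ⁻¹) ≡ - f x
  f-⁻¹ x = begin
    f (x ⁻¹)               ≡⟨ lemma (f x) (f (x ⁻¹)) ⟩
    (f x + f (x ⁻¹)) - f x ≡⟨ cong (_- f x) (f-∙ x (x ⁻¹)) ⟨
    f (x ∙ x ⁻¹) - f x     ≡⟨ cong (_- f x) (trans (f-cong (inverseʳ x)) f-ε) ⟩
    0ℤ - f x               ≡⟨ +-identityˡ (- f x) ⟩
    - f x                  ∎
    where
    open ≡-Reasoning
    lemma : ∀ a b → b ≡ (a + b) - a
    lemma = solve-∀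

  private
    f-×ₙ : ∀ n x → f (multiple A (+ n) x) ≡ + n * f x
    f-×ₙ zero    x = f-ε
    f-×ₙ (suc n) x = trans (f-∙ x _) (trans (cong (λ t → f x + t) (f-×ₙ n x)) (sym (suc-* (+ n) (f x))))

  f-multiple : ∀ z x → f (multiple A z x) ≡ z * f x
  f-multiple (+ n)    x = f-×ₙ n x
  f-multiple -[1+ n ] x = trans (f-⁻¹ _)
      (trans (cong -_ (f-×ₙ (suc n) x)) (neg-distribˡ-* (+ suc n) (f x)))

  f-sum : ∀ {n} (c : Vector ℤ n) (v : Vector ∣ A ∣ n) →
          f (sum rawMonoid λ i → multiple A (c i) (v i)) ≡ sumℤ λ i → c i * f (v i)
  f-sum {zero}  c v = f-ε
  f-sum {suc n} c v = trans (f-∙ _ _)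
    (cong₂ _+_ (f-multiple (c Fin.zero) (v Fin.zero)) (f-sum (c ∘ Fin.suc) (v ∘ Fin.suc)))

  homomorphism : ∣ Dual A ∣
  homomorphism = record
    { ⟦_⟧ = f
    ; isGroupHomomorphism = record
      { isMonoidHomomorphism = record
        { isMagmaHomomorphism = record
          { isRelHomomorphism = record { cong = f-cong }
          ; homo = f-∙
          }
        ; ε-homo = f-ε
        }
      ; ⁻¹-homo = f-⁻¹
      }
    }

open AdditiveProperties

Additive-linear : ∀ {A f g} p q → Additive A f → Additive A g → Additive A (λ x → p * f x + q * g x)
Additive-linear {f = f} {g} p q af ag = record
  { f-cong = λ x≈y → cong₂ (λ s t → p * s + q * t) (f-cong af x≈y) (f-cong ag x≈y)
  ; f-∙    = λ x y → trans (cong₂ (λ s t → p * s + q * t) (f-∙ af x y) (f-∙ ag x y))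
                       (lemma p q (f x) (f y) (g x) (g y))
  }
  where
  open Additive
  lemma : ∀ p q a b c d → p * (a + b) + q * (c + d) ≡ (p * a + q * c) + (p * b + q * d)
  lemma = solve-∀

Additive-∘ : ∀ {A B f} (φ : ∣ Hom A B ∣) → Additive B f → Additive A (f ∘ GroupHomomorphism.⟦_⟧ φ)
Additive-∘ φ af = record
  { f-cong = λ x≈y → f-cong (⟦⟧-cong x≈y)
  ; f-∙    = λ x y → trans (f-cong (homo x y)) (f-∙ _ _)
  }
  where
  open Additive af
  open GroupHomomorphism φ

P-coordinate : ∀ j → Additive P (λ x → x j)
P-coordinate j = record { f-cong = λ x≈y → x≈y j ; f-∙ = λ _ _ → refl }

Subgroup-additive : ∀ {A f} (H : Subgroup A) → Additive A f → Additive (Subgroup.group H) (f ∘ proj₁)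
Subgroup-additive H af = record { f-cong = f-cong ; f-∙ = λ _ _ → f-∙ _ _ }
  where open Additive af

-- An independent system of the largest size that occurs is maximal; the search for this size
-- descends from the bound.
bounded⇒finiteRank : (∀ ℓ → ExcludedMiddle ℓ) → ∀ A n →
  (∀ (v : Vector ∣ A ∣ (suc n)) → ¬ IsIndependent A v) → HasFiniteRank A
bounded⇒finiteRank em A zero    none = 0 , (λ ()) , (λ _ _ ()) , λ a → none (a Vector.∷ λ ())
bounded⇒finiteRank em A (suc n) none with em 0ℓ {Σ[ v ∈ Vector ∣ A ∣ (suc n) ] IsIndependent A v}
... | yes (v , ind) = suc n , v , ind , λ a → none (a Vector.∷ v)
... | no  ¬ind      = bounded⇒finiteRank em A n λ v ind → ¬ind (v , ind)

-- The group G

-- From some `N` on the entries are divisible by `suc n`, so adding a multiple of `suc n` can cancel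
-- all of them and leaves finite support.
Null⊆D : ∀ {x} → Null x → Member D x
Null⊆D {x} x→0 n = y , N , λ i N≤i →
    trans (cong (λ t → x i + t) (f-multiple (P-coordinate i) (+ suc n) y))
    (cancels i N≤i)
  where
  N = proj₁ (x→0 (+ suc n) λ ())
  d∣x = proj₂ (x→0 (+ suc n) λ ())
  y : V
  y i with N ℕ.≤? i
  ... | yes N≤i = - quotient (d∣x i N≤i)
  ... | no  _   = 0ℤ
  cancels : ∀ i → N ℕ.≤ i → x i + + suc n * y i ≡ 0ℤ
  cancels i N≤i with N ℕ.≤? i
  ... | no  N≰i = contradiction N≤i N≰i
  ... | yes l   = trans (cong (_+ + suc n * - quotient (d∣x i l)) (_∣_.equality (d∣x i l)))
                        (lemma (quotient (d∣x i l)) (+ suc n))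
    where
    lemma : ∀ q d → q * d + d * - q ≡ 0ℤ
    lemma = solve-∀

module Construction (W : StrictTotalOrder 0ℓ 0ℓ 0ℓ) (tower : Tower W) where
  private module W = StrictTotalOrder W
  open W using () renaming (Carrier to I)
  open Tower tower

  Integral : V → Set
  Integral x = ∀ w → ∃[ z ] Pairs (B w) x z

  abstract
    linear-closed : ∀ p q {x y} → Null x × Integral x → Null y × Integral y →
      Null (λ i → p * x i + q * y i) × Integral (λ i → p * x i + q * y i)
    linear-closed p q (x→0 , x-int) (y→0 , y-int) = Null-linear p q x→0 y→0 ,
      λ w → let (z , h) = x-int w ; (z′ , h′) = y-int w in p * z + q * z′ , Pairs-linearʳ p q h h′

    respects : ∀ {x y} → (∀ i → x i ≡ y i) → Null x × Integral x → Null y × Integral y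
    respects x≗y (x→0 , x-int) = Null-cong x≗y x→0 , λ w → let (z , h) = x-int w in z , Pairs-congʳ x≗y h

    finite-closed : ∀ {x} → Member S x → Null x × Integral x
    finite-closed (N , x≗0) = Null-eventually N x≗0 , λ w → _ , Pairs-finite N x≗0

  H : Subgroup P
  H = record
    { Member    = λ x → Null x × Integral x
    ; resp      = respects
    ; ε-closed  = finite-closed (0 , λ _ _ → refl)
    ; ∙-closed  = λ {x} {y} x∈ y∈ → respects (λ i → 1* (x i) (y i)) (linear-closed 1ℤ 1ℤ x∈ y∈)
    ; ⁻¹-closed = λ {x} x∈ → respects (λ i → neg (x i)) (linear-closed -1ℤ 0ℤ x∈ x∈)
    }
    where
    1* : ∀ a b → 1ℤ * a + 1ℤ * b ≡ a + b
    1* = solve-∀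
    neg : ∀ a → -1ℤ * a + 0ℤ * a ≡ - a
    neg = solve-∀

  G : Ab
  G = Subgroup.group H

  divide : ∀ {k x} → k ≢ 0ℤ → Member H (λ i → k * x i) → Member H x
  divide k≢0 (x→0 , x-int) = Null-cancel k≢0 x→0 , λ w → Pairs-divide k≢0 (proj₂ (x-int w))

  S⊆H : Member S ⊆ Member H
  S⊆H = finite-closed

  H⊆D : Member H ⊆ Member D
  H⊆D (x→0 , _) = Null⊆D x→0

  pure : ∀ {K} → Member H ⊆ K → IsPure P (Member H) K
  pure {K} H⊆K z = to , from
    where
    at : ∀ h i → multiple P z h i ≡ z * h i
    at h i = f-multiple (P-coordinate i) z h
    to : ∀ {x} → Member H x × multiples P z K x → multiples P z (Member H) x
    to {x} (x∈H , h , h∈K , x≈zh) with z ≟ 0ℤ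
    -- For `z = 0` the given `h` need not lie in `H`, but `x` is zero and 0 serves instead.
    ... | yes refl = (λ _ → 0ℤ) , finite-closed (0 , λ _ _ → refl) ,
        λ i → trans (x≈zh i) (trans (at h i) (sym (at (λ _ → 0ℤ) i)))
    ... | no  z≢0  = h , divide z≢0 (respects (λ i → trans (x≈zh i) (at h i)) x∈H) , x≈zh
    from : ∀ {x} → multiples P z (Member H) x → Member H x × multiples P z K x
    from (h , h∈H , x≈zh) = respects (λ i → sym (trans (x≈zh i) (trans (at h i) (pad z (h i)))))
        (linear-closed z 0ℤ h∈H h∈H) ,
      h , H⊆K h∈H , x≈zh
      where
      pad : ∀ z a → z * a ≡ z * a + 0ℤ * a
      pad = solve-∀

  coordinate : ∀ j → Additive G (λ x → proj₁ x j)
  coordinate j = Subgroup-additive H (P-coordinate j)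

  e : ℕ → ∣ G ∣
  e i = δ i , finite-closed (suc i , λ j i<j → δ-off (ℕ.<⇒≢ i<j))

  module Pairing (b : V) (integral : ∀ (x : ∣ G ∣) → ∃[ z ] Pairs b (proj₁ x) z) where

    functional : ∣ G ∣ → ℤ
    functional x = proj₁ (integral x)

    additive : Additive G functional
    additive = record
      { f-cong = λ {x} {y} x≈y → Pairs-unique (Pairs-congʳ x≈y (proj₂ (integral x))) (proj₂ (integral y))
      ; f-∙    = λ x y → Pairs-unique (proj₂ (integral (Subgroup.group H .AbelianGroup._∙_ x y)))
          (subst (Pairs b (λ i → proj₁ x i + proj₁ y i)) (1* (functional x) (functional y))
              (Pairs-congʳ (λ i → 1* (proj₁ x i) (proj₁ y i))
            (Pairs-linearʳ 1ℤ 1ℤ (proj₂ (integral x)) (proj₂ (integral y)))))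
      }
      where
      1* : ∀ a b → 1ℤ * a + 1ℤ * b ≡ a + b
      1* = solve-∀

    functional-e : ∀ j → functional (e j) ≡ b j
    functional-e j = Pairs-unique (proj₂ (integral (e j))) (Pairs-δʳ b j)

  module B-pairing (w : I) = Pairing (B w) (λ x → proj₂ (proj₂ x) w)

  -- The values of a pairing at the unit vectors recover `B w`, and these sequences are distinct; so
  -- a countable dual would make the index set ω₁ countable.
  dual-uncountable : Uncountable W.Eq.setoid → Uncountable (AbelianGroup.setoid (Dual G))
  dual-uncountable uncountable countable = uncountable record
    { to        = to ∘ β
    ; cong      = λ {v} {w} v≈w → cong-to {β v} {β w} (β-cong v≈w)
    ; injective = λ {v} {w} eq → injective-β v w (injective {β v} {β w} eq)
    }
    where
    open Injection countable using (to; injective) renaming (cong to cong-to)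
    β : I → ∣ Dual G ∣
    β w = homomorphism (B-pairing.additive w)
    β-cong : ∀ {v w} → v W.≈ w → AbelianGroup._≈_ (Dual G) (β v) (β w)
    β-cong {v} {w} v≈w x = Pairs-unique {b = B w} {proj₁ x}
      (subst (λ b → Pairs b (proj₁ x) (B-pairing.functional v x)) (B-cong v≈w)
          (proj₂ (proj₂ (proj₂ x) v)))
      (proj₂ (proj₂ (proj₂ x) w))
    β-faithful : ∀ v w → AbelianGroup._≈_ (Dual G) (β v) (β w) → ∀ j → B v j ≡ B w j
    β-faithful v w β≈ j = begin
      B v j                        ≡⟨ B-pairing.functional-e v j ⟨
      B-pairing.functional v (e j) ≡⟨ β≈ (e j) ⟩
      B-pairing.functional w (e j) ≡⟨ B-pairing.functional-e w j ⟩
      B w j                        ∎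
      where open ≡-Reasoning
    injective-β : ∀ v w → AbelianGroup._≈_ (Dual G) (β v) (β w) → v W.≈ w
    injective-β v w β≈ = compare (W.compare v w)
      where
      compare : Tri (v W.< w) (v W.≈ w) (w W.< v) → v W.≈ w
      compare (tri≈ _ v≈w _) = v≈w
      compare (tri< v<w _ _) = contradiction (β-faithful v w β≈) (fresh v<w)
      compare (tri> _ _ w<v) = contradiction (λ j → sym (β-faithful v w β≈ j)) (fresh w<v)

-- Endomorphisms of G

module Limits (W : StrictTotalOrder 0ℓ 0ℓ 0ℓ) (tower : Tower W) where
  open Tower tower
  open Construction W tower
  private module G = AbelianGroup G

  -- Formed as a combination of the `e m` inside `G`, so that an arbitrary additive functional can
  -- be evaluated on it termwise.
  truncate : ℕ → ∣ G ∣ → ∣ G ∣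
  truncate zero    x = G.ε
  truncate (suc m) x = truncate m x G.∙ multiple G (proj₁ x m) (e m)

  truncate-additive : ∀ {f} → Additive G f → ∀ m x → f (truncate m x) ≡ dot (f ∘ e) (proj₁ x) m
  truncate-additive     af zero    x = f-ε af
  truncate-additive {f} af (suc m) x =
      trans (Additive.f-∙ af (truncate m x) (multiple G (proj₁ x m) (e m)))
    (cong₂ _+_ (truncate-additive af m x)
        (trans (f-multiple af (proj₁ x m) (e m)) (*-comm (proj₁ x m) (f (e m)))))

  truncate-coordinate : ∀ m x i → proj₁ (truncate m x) i ≡ dot (proj₁ x) (δ i) m
  truncate-coordinate m x i = trans (truncate-additive (coordinate i) m x)
    (Σ<-cong m λ t _ → trans (*-comm (δ t i) (proj₁ x t)) (cong (proj₁ x t *_) (δ-sym t i)))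

  -- What remains of `x` after truncation is divisible by `d` in every coordinate, and the quotient
  -- stays in `G` by purity.
  tail : ∀ x m d → d ≢ 0ℤ → (∀ i → m ℕ.≤ i → d ∣ proj₁ x i) →
         ∃[ t ] x G.≈ truncate m x G.∙ multiple G d t
  tail x m d d≢0 d∣x = (t , t∈H) , λ i → trans (split i)
      (cong (λ s → proj₁ (truncate m x) i + s) (sym (f-multiple (coordinate i) d (t , t∈H))))
    where
    t : V
    t i with m ℕ.≤? i
    ... | yes m≤i = quotient (d∣x i m≤i)
    ... | no  _   = 0ℤ
    split : ∀ i → proj₁ x i ≡ proj₁ (truncate m x) i + d * t i
    split i with m ℕ.≤? i
    ... | yes m≤i = trans (_∣_.equality (d∣x i m≤i)) (trans (*-comm (quotient (d∣x i m≤i)) d)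
            (trans (sym (+-identityˡ _)) (cong (_+ d * quotient (d∣x i m≤i))
              (sym (trans (truncate-coordinate m x i)
                (dot-zero (proj₁ x) m λ j j<m → δ-off (ℕ.<⇒≢ (ℕ.<-≤-trans j<m m≤i) ∘ sym)))))))
    ... | no  m≰i = trans (sym (trans (truncate-coordinate m x i) (dot-δ (proj₁ x) (ℕ.≰⇒> m≰i))))
            (lemma (proj₁ (truncate m x) i) d)
      where
      lemma : ∀ a d → a ≡ a + d * 0ℤ
      lemma = solve-∀
    t∈H : Member H t
    t∈H = divide d≢0 (respects (λ i → trans (cong (λ a → 1ℤ * a + -1ℤ * proj₁ (truncate m x) i) (split i))
        (lemma (proj₁ (truncate m x) i) (d * t i)))
      (linear-closed 1ℤ -1ℤ (proj₂ x) (proj₂ (truncate m x))))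
      where
      lemma : ∀ a b → 1ℤ * (a + b) + -1ℤ * a ≡ b
      lemma = solve-∀

  -- Since G is pure and G / S is divisible, a functional is determined by its values on S.
  continuous : ∀ {f} → Additive G f → ∀ x → Pairs (f ∘ e) (proj₁ x) (f x)
  continuous {f} af x = pairs λ d d≢0 → let (N , d∣x) = proj₁ (proj₂ x) d d≢0 in
    N , λ m N≤m → approximate d d≢0 m λ i m≤i → d∣x i (ℕ.≤-trans N≤m m≤i)
    where
    open ≡-Reasoning
    approximate : ∀ d → d ≢ 0ℤ → ∀ m → (∀ i → m ℕ.≤ i → d ∣ proj₁ x i) → d ∣ dot (f ∘ e) (proj₁ x) m - f x
    approximate d d≢0 m d∣x = divides (- f t) (begin
      s - f x                                    ≡⟨ cong (λ a → s - a) (Additive.f-cong af x≈) ⟩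
      s - f (truncate m x G.∙ multiple G d t)
          ≡⟨ cong (λ a → s - a) (Additive.f-∙ af (truncate m x) (multiple G d t)) ⟩
      s - (f (truncate m x) + f (multiple G d t))
          ≡⟨ cong₂ (λ a b → s - (a + b)) (truncate-additive af m x) (f-multiple af d t) ⟩
      s - (s + d * f t)                          ≡⟨ lemma s d (f t) ⟩
      - f t * d                                  ∎)
      where
      s = dot (f ∘ e) (proj₁ x) m
      t = proj₁ (tail x m d d≢0 d∣x)
      x≈ = proj₂ (tail x m d d≢0 d∣x)
      lemma : ∀ s d a → s - (s + d * a) ≡ - a * d
      lemma = solve-∀

  -- Finitely many functionals already force all `χ j` to vanish. Hence any `suc size` elements have
  -- a nontrivial combination that every `χ j` kills, which is how the finite corank is used.
  record FiniteCodimension (χ : ℕ → ∣ G ∣ → ℤ) : Set where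
    field
      size     : ℕ
      F        : Fin.Fin size → ∣ G ∣ → ℤ
      additive : ∀ s → Additive G (F s)
      kernel   : ∀ x → (∀ s → F s x ≡ 0ℤ) → ∀ j → χ j x ≡ 0ℤ

    relation : (v : Vector ∣ G ∣ (suc size)) →
      Σ[ c ∈ Vector ℤ (suc size) ] (∃[ t ] c t ≢ 0ℤ) ×
        (∀ j → χ j (sum G.rawMonoid λ t → multiple G (c t) (v t)) ≡ 0ℤ)
    relation v =
      let (c , c≢0 , Fc≡0) = kernel-vector size (λ s t → F s (v t)) in
      c , c≢0 , kernel _ λ s → trans (f-sum (additive s) c v) (Fc≡0 s)

module Endomorphism (em : ∀ ℓ → ExcludedMiddle ℓ) (W : StrictTotalOrder 0ℓ 0ℓ 0ℓ) (tower : Tower W)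
                    (φ : ∣ End (Construction.G W tower) ∣) where
  open Tower tower using (X; B; X-null; pairing; kills)
  open Construction W tower
  open Limits W tower
  open GroupHomomorphism φ using (⟦_⟧; ⟦⟧-cong; homo)
  private module G = AbelianGroup G

  φ-coordinate : ∀ j → Additive G (λ x → proj₁ (⟦ x ⟧) j)
  φ-coordinate j = Additive-∘ {G} {G} φ (coordinate j)

  M : Matrix
  M j i = proj₁ ⟦ e i ⟧ j

  abstract
    -- The image of `X w` under `φ` lies in `G`, so `B w` is integral on it; at the stage of `M`
    -- this leaves only the nearly scalar case.
    killed : Σ[ C ∈ Matrix ] (∀ n → (∃[ v ] C n ≡ B v) ⊎ (∀ i → C n i ≡ 0ℤ)) × NearlyScalar M C
    killed = proj₂ (kills M) (proj₁ ⟦ x ⟧) (λ j → continuous (φ-coordinate j) x)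
        (proj₁ (proj₂ (proj₂ ⟦ x ⟧) w)) (Pairs-sym (proj₂ (proj₂ (proj₂ ⟦ x ⟧) w)))
      where
      w : StrictTotalOrder.Carrier W
      w = proj₁ (kills M)
      x : ∣ G ∣
      x = X w , X-null w , λ v → pairing v w

  C : Matrix
  C = proj₁ killed

  C-integral : ∀ n (x : ∣ G ∣) → ∃[ z ] Pairs (C n) (proj₁ x) z
  C-integral n x = [ (λ (v , eq) → subst (λ b → ∃[ z ] Pairs b (proj₁ x) z) (sym eq) (proj₂ (proj₂ x) v))
                   , (λ C≗0 → 0ℤ , Pairs-zeroˡ C≗0) ]′ (proj₁ (proj₂ killed) n)

  module C-pairing n = Pairing (C n) (C-integral n)

  open NearlyScalar (proj₂ (proj₂ killed)) using (k; k≢0; l; J; m; n; relation)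

  ψ : ℕ → ∣ G ∣ → ℤ
  ψ j x = k * proj₁ ⟦ x ⟧ j + - l * proj₁ x j

  ψ-additive : ∀ j → Additive G (ψ j)
  ψ-additive j = Additive-linear k (- l) (φ-coordinate j) (coordinate j)

  ψ-row : ∀ j x → Pairs (row M k l j) (proj₁ x) (ψ j x)
  ψ-row j x = Pairs-linearˡ k (- l) (continuous (φ-coordinate j) x) (Pairs-sym (Pairs-δʳ (proj₁ x) j))

  -- Let the first `m` entries of `x`, its pairings with the first `n` rows of `C` and the first `J`
  -- values `ψ j x` vanish. A later row satisfies its dependence from column `m` on, and `x`
  -- vanishes before; so a nonzero multiple of `ψ j x` is a combination of zeros.
  finite-codimension : FiniteCodimension ψ
  finite-codimension = record
    { size     = m ℕ.+ (n ℕ.+ J)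
    ; F        = λ s → F (index s)
    ; additive = λ s → F-additive (index s)
    ; kernel   = λ x F≡0 → kernel x λ u → subst (λ v → F v x ≡ 0ℤ) (index-code u) (F≡0 (code u))
    }
    where
    Index : Set
    Index = Fin.Fin m ⊎ Fin.Fin n ⊎ Fin.Fin J

    F : Index → ∣ G ∣ → ℤ
    F (inj₁ i)        x = proj₁ x (toℕ i)
    F (inj₂ (inj₁ t)) x = C-pairing.functional (toℕ t) x
    F (inj₂ (inj₂ j)) x = ψ (toℕ j) x

    F-additive : ∀ u → Additive G (F u)
    F-additive (inj₁ i)        = coordinate (toℕ i)
    F-additive (inj₂ (inj₁ t)) = C-pairing.additive (toℕ t)
    F-additive (inj₂ (inj₂ j)) = ψ-additive (toℕ j)

    index : Fin.Fin (m ℕ.+ (n ℕ.+ J)) → Index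
    index s = [ inj₁ , (λ r → inj₂ (splitAt n r)) ]′ (splitAt m s)

    code : Index → Fin.Fin (m ℕ.+ (n ℕ.+ J))
    code u = join m (n ℕ.+ J) ([ inj₁ , (λ r → inj₂ (join n J r)) ]′ u)

    index-code : ∀ u → index (code u) ≡ u
    index-code (inj₁ i) = cong [ inj₁ , (λ r → inj₂ (splitAt n r)) ]′
        (Fin.splitAt-join m (n ℕ.+ J) (inj₁ i))
    index-code (inj₂ r) = trans
      (cong [ inj₁ , (λ r → inj₂ (splitAt n r)) ]′ (Fin.splitAt-join m (n ℕ.+ J) (inj₂ (join n J r))))
      (cong inj₂ (Fin.splitAt-join n J r))

    kernel : ∀ x → (∀ u → F u x ≡ 0ℤ) → ∀ j → ψ j x ≡ 0ℤ
    kernel x F≡0 j = cases (J ℕ.≤? j)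
      where
      vanish : ∀ j → ψ (J ℕ.+ j) x ≡ 0ℤ
      vanish j = *-cancelˡ-≡0 q≢0 (trans (pad q (ψ (J ℕ.+ j) x))
          (trans (Pairs-unique scaled combined) sum≡0))
        where
        q = proj₁ (relation j)
        q≢0 = proj₁ (proj₂ (relation j))
        c = proj₁ (proj₂ (proj₂ (relation j)))
        rel = proj₂ (proj₂ (proj₂ (relation j)))
        pad : ∀ a b → a * b ≡ a * b + 0ℤ * b
        pad = solve-∀
        combination : V
        combination i = Σ< n λ t → c t * C t i
        scaled : Pairs combination (proj₁ x) (q * ψ (J ℕ.+ j) x + 0ℤ * ψ (J ℕ.+ j) x)
        scaled = Pairs-termwise termwise (Pairs-linearˡ q 0ℤ (ψ-row (J ℕ.+ j) x) (ψ-row (J ℕ.+ j) x))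
          where
          r : V
          r = row M k l (J ℕ.+ j)
          termwise : ∀ i → (q * r i + 0ℤ * r i) * proj₁ x i ≡ combination i * proj₁ x i
          termwise i = termwise′ (m ℕ.≤? i)
            where
            termwise′ : Dec (m ℕ.≤ i) → (q * r i + 0ℤ * r i) * proj₁ x i ≡ combination i * proj₁ x i
            termwise′ (yes m≤i) = cong (_* proj₁ x i) (trans (sym (pad q (r i))) (rel i m≤i))
            termwise′ (no m≰i) = trans (cong (λ a → (q * r i + 0ℤ * r i) * a) x≡0)
              (trans (zeros (q * r i + 0ℤ * r i) (combination i))
                  (cong (λ a → combination i * a) (sym x≡0)))
                where
                zeros : ∀ a b → a * 0ℤ ≡ b * 0ℤ
                zeros = solve-∀
                x≡0 : proj₁ x i ≡ 0ℤ
                x≡0 = subst (λ i → proj₁ x i ≡ 0ℤ) (Fin.toℕ-fromℕ< (ℕ.≰⇒> m≰i))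
                    (F≡0 (inj₁ (fromℕ< (ℕ.≰⇒> m≰i))))
        combined : Pairs combination (proj₁ x) (Σ< n λ t → c t * C-pairing.functional t x)
        combined = Pairs-Σ n c λ t → proj₂ (C-integral t x)
        sum≡0 : (Σ< n λ t → c t * C-pairing.functional t x) ≡ 0ℤ
        sum≡0 = Σ<-zero n λ t t<n → trans (cong (c t *_)
          (subst (λ t → C-pairing.functional t x ≡ 0ℤ) (Fin.toℕ-fromℕ< t<n)
              (F≡0 (inj₂ (inj₁ (fromℕ< t<n))))))
          (*-zeroʳ (c t))

      cases : Dec (J ℕ.≤ j) → ψ j x ≡ 0ℤ
      cases (no J≰j) = subst (λ j → ψ j x ≡ 0ℤ) (Fin.toℕ-fromℕ< (ℕ.≰⇒> J≰j))
          (F≡0 (inj₂ (inj₂ (fromℕ< (ℕ.≰⇒> J≰j)))))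
      cases (yes J≤j) = subst (λ j → ψ j x ≡ 0ℤ) (ℕ.m+[n∸m]≡n J≤j) (vanish (j ℕ.∸ J))

  open FiniteCodimension finite-codimension using (size) renaming (relation to dependence)

  -- A dependence among `suc size` unit vectors modulo the kernel; the coordinates of the
  -- combination are its coefficients, so it is nonzero.
  kernel-element : ∃[ v ] (∀ j → ψ j v ≡ 0ℤ) × ∃[ i ] proj₁ v i ≢ 0ℤ
  kernel-element =
    let (c , (t , ct≢0) , ψ≡0) = dependence (e ∘ toℕ) in
    sum G.rawMonoid (λ t → multiple G (c t) (e (toℕ t))) , ψ≡0 , toℕ t ,
    λ eq → ct≢0 (trans (sym (trans (f-sum (coordinate (toℕ t)) c (e ∘ toℕ)) (sumℤ-δ c t))) eq)

  -- The kernel of ψ is closed under φ, so the Euclidean algorithm applied to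
  -- the i-th coordinates of v and φ v stays inside it; when the remainder
  -- vanishes, k (φ v)ᵢ = l vᵢ exhibits l as a multiple of k.
  k∣l : ∀ i b → ∀ v → ℤ.∣ proj₁ v i ∣ ≡ b → proj₁ v i ≢ 0ℤ → (∀ j → ψ j v ≡ 0ℤ) → ∃[ z ] l ≡ k * z
  k∣l i = <-rec _ λ b rec v → euclid b v rec
    where
    euclid : ∀ b v →
      (∀ {b′} → b′ ℕ.< b → ∀ v → ℤ.∣ proj₁ v i ∣ ≡ b′ → proj₁ v i ≢ 0ℤ →
          (∀ j → ψ j v ≡ 0ℤ) → ∃[ z ] l ≡ k * z) →
      ℤ.∣ proj₁ v i ∣ ≡ b → proj₁ v i ≢ 0ℤ → (∀ j → ψ j v ≡ 0ℤ) → ∃[ z ] l ≡ k * z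
    euclid b v rec refl vᵢ≢0 ψ≡0 = finish (r ℕ.≟ 0)
      where
      instance
        nz : ℤ.NonZero (proj₁ v i)
        nz = ℤ.≢-nonZero vᵢ≢0
      z : ℤ
      z = proj₁ ⟦ v ⟧ i ℤ./ proj₁ v i
      r : ℕ
      r = proj₁ ⟦ v ⟧ i ℤ.% proj₁ v i
      division : proj₁ ⟦ v ⟧ i ≡ + r + z * proj₁ v i
      division = ℤ.a≡a%n+[a/n]*n (proj₁ ⟦ v ⟧ i) (proj₁ v i)
      u : ∣ G ∣
      u = ⟦ v ⟧ G.∙ multiple G (- z) v
      u-additive : ∀ {f} → Additive G f → f u ≡ f ⟦ v ⟧ + - z * f v
      u-additive {f} af = trans (Additive.f-∙ af ⟦ v ⟧ (multiple G (- z) v))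
        (cong (λ a → f ⟦ v ⟧ + a) (f-multiple af (- z) v))
      uᵢ : proj₁ u i ≡ + r
      uᵢ = trans (u-additive (coordinate i)) (trans (cong (λ a → a + - z * proj₁ v i) division)
          (lemma (+ r) z (proj₁ v i)))
        where
        lemma : ∀ r z a → (r + z * a) + - z * a ≡ r
        lemma = solve-∀
      k*φv : ∀ j → k * proj₁ ⟦ v ⟧ j ≡ l * proj₁ v j
      k*φv j = trans (lemma k (proj₁ ⟦ v ⟧ j) l (proj₁ v j))
        (trans (cong (λ a → a + l * proj₁ v j) (ψ≡0 j)) (+-identityˡ _))
        where
        lemma : ∀ k a l b → k * a ≡ (k * a + - l * b) + l * b
        lemma = solve-∀
      -- Applying `φ` to `k φ v = l v` shows that `φ v` lies in the kernel of `ψ` as well.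
      kφφv : ∀ j → k * proj₁ ⟦ ⟦ v ⟧ ⟧ j ≡ l * proj₁ ⟦ v ⟧ j
      kφφv j = begin
        k * proj₁ ⟦ ⟦ v ⟧ ⟧ j                 ≡⟨ f-multiple (φ-coordinate j) k ⟦ v ⟧ ⟨
        proj₁ ⟦ multiple G k ⟦ v ⟧ ⟧ j
            ≡⟨ ⟦⟧-cong {multiple G k ⟦ v ⟧} {multiple G l v}
            (λ j → trans (f-multiple (coordinate j) k ⟦ v ⟧)
                                                   (trans (k*φv j) (sym (f-multiple (coordinate j) l v)))) j ⟩
        proj₁ ⟦ multiple G l v ⟧ j            ≡⟨ f-multiple (φ-coordinate j) l v ⟩
        l * proj₁ ⟦ v ⟧ j                     ∎
        where open ≡-Reasoning
      ψu : ∀ j → ψ j u ≡ 0ℤ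
      ψu j = begin
        ψ j u                        ≡⟨ u-additive (ψ-additive j) ⟩
        ψ j ⟦ v ⟧ + - z * ψ j v
            ≡⟨ cong₂ (λ a b → (a + - l * proj₁ ⟦ v ⟧ j) + - z * b) (kφφv j) (ψ≡0 j) ⟩
        (l * proj₁ ⟦ v ⟧ j + - l * proj₁ ⟦ v ⟧ j) + - z * 0ℤ ≡⟨ lemma l (proj₁ ⟦ v ⟧ j) z ⟩
        0ℤ                           ∎
        where
        open ≡-Reasoning
        lemma : ∀ l a z → (l * a + - l * a) + - z * 0ℤ ≡ 0ℤ
        lemma = solve-∀
      finish : Dec (r ≡ 0) → ∃[ z ] l ≡ k * z
      finish (no r≢0) = rec r<b u (cong ℤ.∣_∣ uᵢ) (λ uᵢ≡0 → r≢0 (+-injective (trans (sym uᵢ) uᵢ≡0))) ψu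
        where
        r<b : r ℕ.< ℤ.∣ proj₁ v i ∣
        r<b = ℤ.n%d<d (proj₁ ⟦ v ⟧ i) (proj₁ v i)
      finish (yes r≡0) = z , *-cancelʳ-≡ l (k * z) (proj₁ v i) (begin
        l * proj₁ v i         ≡⟨ k*φv i ⟨
        k * proj₁ ⟦ v ⟧ i     ≡⟨ cong (k *_) (trans division (cong (λ r → + r + z * proj₁ v i) r≡0)) ⟩
        k * (0ℤ + z * proj₁ v i) ≡⟨ lemma k z (proj₁ v i) ⟩
        k * z * proj₁ v i     ∎)
        where
        open ≡-Reasoning
        lemma : ∀ k z a → k * (0ℤ + z * a) ≡ k * z * a
        lemma = solve-∀

  scalar : ∃[ z ] l ≡ k * z
  scalar = let (v , ψ≡0 , i , vᵢ≢0) = kernel-element in k∣l i _ v refl vᵢ≢0 ψ≡0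

-- The decomposition of the endomorphism group

module Splitting (em : ∀ ℓ → ExcludedMiddle ℓ) (W : StrictTotalOrder 0ℓ 0ℓ 0ℓ) (tower : Tower W) where
  open Classical em
  open Construction W tower
  open Limits W tower
  open GroupHomomorphism using (⟦_⟧)
  private module G = AbelianGroup G

  ext : ∀ (χ : ∣ End G ∣) → Ab
  ext χ = Subgroup.group (Image G G χ)

  image-coordinate : ∀ χ j → Additive (ext χ) (λ y → proj₁ (proj₁ y) j)
  image-coordinate χ j = Subgroup-additive (Image G G χ) (coordinate j)

  -- Lift `suc size` elements of the image to `G`: the relation found there is killed by `χ`, so the
  -- elements themselves are dependent.
  finite-rank : ∀ χ → FiniteCodimension (λ j x → proj₁ (⟦ χ ⟧ x) j) → Fin G χ
  finite-rank χ fc = bounded⇒finiteRank em (ext χ) size λ v independent →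
      let (c , (t , ct≢0) , χ≡0) = relation (preimage v) in
      ct≢0 (independent c (λ j → vanishes v c j (χ≡0 j)) t)
    where
    open FiniteCodimension fc
    preimage : ∀ {n} → Vector ∣ ext χ ∣ n → Vector ∣ G ∣ n
    preimage v t = proj₁ (proj₂ (v t))
    vanishes : ∀ {n} (v : Vector ∣ ext χ ∣ n) c j →
      proj₁ (⟦ χ ⟧ (sum G.rawMonoid λ t → multiple G (c t) (preimage v t))) j ≡ 0ℤ →
      proj₁ (proj₁ (sum (AbelianGroup.rawMonoid (ext χ)) λ t → multiple (ext χ) (c t) (v t))) j ≡ 0ℤ
    vanishes v c j χ≡0 = begin
      _                                                         ≡⟨ f-sum (image-coordinate χ j) c v ⟩
      sumℤ (λ t → c t * proj₁ (proj₁ (v t)) j)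
          ≡⟨ sumℤ-cong (λ t → cong (c t *_) (proj₂ (proj₂ (v t)) j)) ⟨
      sumℤ (λ t → c t * proj₁ (⟦ χ ⟧ (preimage v t)) j)
        ≡⟨ f-sum (Additive-∘ {G} {G} χ (coordinate j)) c (preimage v) ⟨
      _                                                         ≡⟨ χ≡0 ⟩
      0ℤ                                                        ∎
      where open ≡-Reasoning

  -- Exchange: each of the n + 1 elements z e₀ , … , z eₙ depends on a maximal
  -- independent system of size n, so there is a relation among them.
  scalar-of-finite-rank : ∀ χ z → (∀ x → ⟦ χ ⟧ x G.≈ multiple G z x) → Fin G χ → z ≡ 0ℤ
  scalar-of-finite-rank χ z χ≈z (n , v , independent , maximal) = dne λ z≢0 →
      *-≢0 (*-≢0 (proj₂ (proj₁ (proj₂ solution))) (proj₁ (proj₂ (relation t₀)))) z≢0 vanishes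
    where
    I = ext χ
    coord : ℕ → ∣ I ∣ → ℤ
    coord j y = proj₁ (proj₁ y) j

    -- If all relations had leading coefficient 0, the independence of `v` would make `y ∷ v`
    -- independent, against maximality.
    dependent : ∀ (y : ∣ I ∣) → Σ[ c ∈ Vector ℤ (suc n) ] c Fin.zero ≢ 0ℤ ×
      (∀ j → c Fin.zero * coord j y + sumℤ (λ i → c (Fin.suc i) * coord j (v i)) ≡ 0ℤ)
    dependent y = dne λ none → maximal y λ c c·≈0 →
      let eq : ∀ j → c Fin.zero * coord j y + sumℤ (λ i → c (Fin.suc i) * coord j (v i)) ≡ 0ℤ
          eq j = trans (sym (f-sum (image-coordinate χ j) c (y Vector.∷ v))) (c·≈0 j)
          c₀≡0 = dne λ c₀≢0 → none (c , c₀≢0 , eq)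
      in λ { Fin.zero → c₀≡0
           ; (Fin.suc i) → independent (c ∘ Fin.suc)
               (λ j → trans (f-sum (image-coordinate χ j) (c ∘ Fin.suc) v)
               (trans (drop (coord j y) _ c₀≡0) (eq j))) i }
      where
      drop : ∀ {c} y s → c ≡ 0ℤ → s ≡ c * y + s
      drop y s refl = sym (+-identityˡ s)

    y : Fin.Fin (suc n) → ∣ I ∣
    y t = ⟦ χ ⟧ (e (toℕ t)) , e (toℕ t) , λ _ → refl

    relation : ∀ t → Σ[ c ∈ Vector ℤ (suc n) ] c Fin.zero ≢ 0ℤ ×
      (∀ j → c Fin.zero * coord j (y t) + sumℤ (λ i → c (Fin.suc i) * coord j (v i)) ≡ 0ℤ)
    relation t = dependent (y t)

    c : Fin.Fin (suc n) → Vector ℤ (suc n)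
    c t = proj₁ (relation t)

    solution : Σ[ d ∈ Vector ℤ (suc n) ] (∃[ t ] d t ≢ 0ℤ) ×
        (∀ i → sumℤ (λ t → d t * c t (Fin.suc i)) ≡ 0ℤ)
    solution = kernel-vector n λ i t → c t (Fin.suc i)

    d : Vector ℤ (suc n)
    d = proj₁ solution

    t₀ : Fin.Fin (suc n)
    t₀ = proj₁ (proj₁ (proj₂ solution))

    -- Coordinate `t₀` of the relations combined with the weights `d t`: the terms in `v` cancel by
    -- the choice of `d`, and among the terms `z eₜ` only the one at `t₀` contributes.
    vanishes : d t₀ * c t₀ Fin.zero * z ≡ 0ℤ
    vanishes = begin
      a t₀                     ≡⟨ sumℤ-δ a t₀ ⟨
      sumℤ g                   ≡⟨ pad (sumℤ g) ⟩
      1ℤ * sumℤ g + 1ℤ * 0ℤ    ≡⟨ cong (λ s → 1ℤ * sumℤ g + 1ℤ * s) Σh≡0 ⟨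
      1ℤ * sumℤ g + 1ℤ * sumℤ h ≡⟨ sumℤ-linear 1ℤ 1ℤ g h ⟨
      sumℤ (λ t → 1ℤ * g t + 1ℤ * h t) ≡⟨ sumℤ-zero g+h ⟩
      0ℤ                       ∎
      where
      open ≡-Reasoning
      s = toℕ t₀
      a g h r : Vector ℤ (suc n)
      r t = sumℤ (λ i → c t (Fin.suc i) * coord s (v i))
      a t = d t * c t Fin.zero * z
      g t = a t * δ (toℕ t) s
      h t = d t * r t
      pad : ∀ a → a ≡ 1ℤ * a + 1ℤ * 0ℤ
      pad = solve-∀
      g+h : ∀ t → 1ℤ * g t + 1ℤ * h t ≡ 0ℤ
      g+h t = begin
        1ℤ * g t + 1ℤ * h t ≡⟨ lemma (d t) (c t Fin.zero) z (δ (toℕ t) s) (r t) ⟩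
        d t * (c t Fin.zero * (z * δ (toℕ t) s) + r t)
            ≡⟨ cong (λ b → d t * (c t Fin.zero * b + r t))
                                                         (trans (χ≈z (e (toℕ t)) s) (f-multiple (coordinate s) z (e (toℕ t)))) ⟨
        d t * (c t Fin.zero * coord s (y t) + r t) ≡⟨ cong (d t *_) (proj₂ (proj₂ (relation t)) s) ⟩
        d t * 0ℤ ≡⟨ *-zeroʳ (d t) ⟩
        0ℤ ∎
        where
        lemma : ∀ d c z e r → 1ℤ * (d * c * z * e) + 1ℤ * (d * r) ≡ d * (c * (z * e) + r)
        lemma = solve-∀
      Σh≡0 : sumℤ h ≡ 0ℤ
      Σh≡0 = begin
        sumℤ h
            ≡⟨ sumℤ-cong (λ t → trans (*-comm (d t) (r t))
            (sym (sumℤ-*ʳ (λ i → c t (Fin.suc i) * coord s (v i)) (d t)))) ⟩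
        sumℤ (λ t → sumℤ λ i → c t (Fin.suc i) * coord s (v i) * d t)
            ≡⟨ sumℤ-swap (λ t i → c t (Fin.suc i) * coord s (v i) * d t) ⟩
        sumℤ (λ i → sumℤ λ t → c t (Fin.suc i) * coord s (v i) * d t) ≡⟨ sumℤ-zero column ⟩
        0ℤ ∎
        where
        column : ∀ i → sumℤ (λ t → c t (Fin.suc i) * coord s (v i) * d t) ≡ 0ℤ
        column i = begin
          sumℤ (λ t → c t (Fin.suc i) * coord s (v i) * d t)
              ≡⟨ sumℤ-cong (λ t → lemma (c t (Fin.suc i)) (coord s (v i)) (d t)) ⟩
          sumℤ (λ t → d t * c t (Fin.suc i) * coord s (v i))
              ≡⟨ sumℤ-*ʳ (λ t → d t * c t (Fin.suc i)) (coord s (v i)) ⟩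
          sumℤ (λ t → d t * c t (Fin.suc i)) * coord s (v i)
              ≡⟨ cong (_* coord s (v i)) (proj₂ (proj₂ solution) i) ⟩
          0ℤ * coord s (v i) ≡⟨ *-zeroˡ (coord s (v i)) ⟩
          0ℤ ∎
          where
          lemma : ∀ c v d → c * v * d ≡ d * c * v
          lemma = solve-∀

  scaling : ℤ → ∣ End G ∣
  scaling z = record
    { ⟦_⟧ = multiple G z
    ; isGroupHomomorphism = record
      { isMonoidHomomorphism = record
        { isMagmaHomomorphism = record
          { isRelHomomorphism = record { cong = λ {x} {y} x≈y i →
              trans (at x i) (trans (cong (z *_) (x≈y i)) (sym (at y i))) }
          ; homo = λ x y i → trans (at (x G.∙ y) i) (trans (*-distribˡ-+ z (proj₁ x i) (proj₁ y i))
              (sym (cong₂ _+_ (at x i) (at y i))))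
          }
        ; ε-homo = λ i → trans (at G.ε i) (*-zeroʳ z)
        }
      ; ⁻¹-homo = λ x i → trans (at (x G.⁻¹) i) (trans (sym (neg-distribʳ-* z (proj₁ x i)))
          (cong -_ (sym (at x i))))
      }
    }
    where
    at : ∀ x i → proj₁ (multiple G z x) i ≡ z * proj₁ x i
    at x i = f-multiple (coordinate i) z x

  directSum : IsInternalDirectSum (End G) (Scalar G) (Fin G)
  directSum = split , disjoint
    where
    split : ∀ φ → ∃[ σ ] ∃[ χ ]
        (Scalar G σ × Fin G χ × AbelianGroup._≈_ (End G) φ (AbelianGroup._∙_ (End G) σ χ))
    split φ = scaling z , χ , (z , λ _ _ → refl) , finite-rank χ codimension ,
        λ x i → lemma₁ (proj₁ (⟦ φ ⟧ x) i) (proj₁ (multiple G z x) i)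
      where
      open Endomorphism em W tower φ
      open NearlyScalar (proj₂ (proj₂ killed)) using (k; k≢0; l)
      z : ℤ
      z = proj₁ scalar
      χ : ∣ End G ∣
      χ = AbelianGroup._-_ (End G) φ (scaling z)
      lemma₁ : ∀ a b → a ≡ b + (a + - b)
      lemma₁ = solve-∀
      -- Because `l = k z`, the functionals that force `ψ` to vanish also force `χ` to vanish, after
      -- cancelling `k`.
      ψ≡kχ : ∀ j x → ψ j x ≡ k * proj₁ (⟦ χ ⟧ x) j
      ψ≡kχ j x = begin
        k * a + - l * b         ≡⟨ cong (λ l → k * a + - l * b) (proj₂ scalar) ⟩
        k * a + - (k * z) * b   ≡⟨ lemma k a z b ⟩
        k * (a + - (z * b))     ≡⟨ cong (λ t → k * (a + - t)) (f-multiple (coordinate j) z x) ⟨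
        k * proj₁ (⟦ χ ⟧ x) j   ∎
        where
        open ≡-Reasoning
        a = proj₁ (⟦ φ ⟧ x) j
        b = proj₁ x j
        lemma : ∀ k a z b → k * a + - (k * z) * b ≡ k * (a + - (z * b))
        lemma = solve-∀
      codimension : FiniteCodimension (λ j x → proj₁ (⟦ χ ⟧ x) j)
      codimension = record
        { size     = F.size
        ; F        = F.F
        ; additive = F.additive
        ; kernel   = λ x F≡0 j → *-cancelˡ-≡0 k≢0 (trans (sym (ψ≡kχ j x)) (F.kernel x F≡0 j))
        }
        where module F = FiniteCodimension finite-codimension

    disjoint : ∀ χ → Scalar G χ → Fin G χ → AbelianGroup._≈_ (End G) χ (AbelianGroup.ε (End G))
    disjoint χ (z , χ≈z) fin x i = trans (χ≈z x i) (trans (f-multiple (coordinate i) z x)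
      (trans (cong (_* proj₁ x i) (scalar-of-finite-rank χ z χ≈z fin)) (*-zeroˡ (proj₁ x i))))

mainTheorem1 : (∀ ℓ → ExcludedMiddle ℓ) →
    (∀ ℓ → AxiomOfChoice ℓ) →
    ContinuumHypothesis →
    Σ[ H ∈ Subgroup P ]
    let G = Subgroup.group H in
    (Member S ⊆ Member H × Member H ⊆ Member D × IsPure P (Member H) (Member D) × IsPure P (Member H) U) ×
    IsInternalDirectSum (End G) (Scalar G) (Fin G) ×
    Uncountable (AbelianGroup.setoid (Dual G))
mainTheorem1 em ac (W , ω₁ , bijection) =
    H , (S⊆H , H⊆D , pure H⊆D , pure (λ _ → _)) ,
    Splitting.directSum em W T , dual-uncountable (HasOrderTypeω₁.uncountable ω₁)
  where
  T : Tower W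
  T = tower em ac W ω₁ bijection
  open Construction W T
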